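{- Let $K$ be an infinite field and $X$ a finite set, $n=|X|$. Then the set of all free bases of $\mathbb{A}_K(X)$ is $0$-definable in $\mathbb{A}_K(X)$; that is, there is a first-order formula $Gen(v_1,\dots,v_n)$ of the language of rings, without parameters, such that for all $a_1,\dots,a_n\in\mathbb{A}_K(X)$, $\mathbb{A}_K(X)\models Gen(a_1,\dots,a_n)$ if and only if $\{a_1,\dots,a_n\}$ is a free basis of $\mathbb{A}_K(X)$ (of cardinality $n$).
   Context: $\mathbb{A}_K(X)$ denotes the free associative unitary algebra over $K$ with free basis $X$, viewed as a structure in the language of rings $\{+,\cdot,0,1\}$. A free basis is a subset $V$ such that $\mathbb{A}_K(X)$ is the free associative unitary $K$-algebra on $V$ (equivalently, the monomials in $V$, including the empty monomial $1$, form a $K$-basis of $\mathbb{A}_K(X)$). -}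

module Defs where

open import Level using (Level; _⊔_) renaming (suc to lsuc)
open import Algebra.Bundles using (CommutativeRing)
open import Data.Nat using (ℕ; zero; suc)
open import Data.Fin using (Fin)
open import Data.Fin.Properties using () renaming (_≟_ to _≟ᶠ_)
open import Data.List using (List; []; _∷_; _++_; map; concatMap)
open import Data.List.Properties using (≡-dec)
open import Data.List.Relation.Unary.All using (All)
open import Data.Product using (Σ; _×_; _,_; proj₁; proj₂)
open import Data.Sum using (_⊎_)
open import Data.Empty using (⊥)
open import Data.Unit.Polymorphic using (⊤)
open import Relation.Nullary using (¬_; yes; no)
open import Relation.Binary.PropositionalEquality using (_≡_)
open import Function using (_∘_)

record Field (c ℓ : Level) : Set (lsuc (c ⊔ ℓ)) where
  field
    commutativeRing : CommutativeRing c ℓ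
  open CommutativeRing commutativeRing public
  field
    0≉1     : ¬ (0# ≈ 1#)
    inverse : ∀ x → ¬ (x ≈ 0#) → Σ Carrier λ y → x * y ≈ 1#

Infinite : ∀ {c ℓ} → Field c ℓ → Set (c ⊔ ℓ)
Infinite K = ∀ (xs : List Carrier) → Σ Carrier λ y → All (λ x → ¬ (y ≈ x)) xs
  where open Field K

-- The free associative unitary K-algebra A_K(X) with X = Fin n.
-- Elements are finite formal K-linear combinations of words (monomials)
-- over X, represented as lists of (coefficient , word); two such lists
-- are equal in A_K(X) iff every word has the same total coefficient.

module FreeAlgebra {c ℓ : Level} (K : Field c ℓ) (n : ℕ) where
  open Field K

  Word : Set
  Word = List (Fin n)

  A : Set c
  A = List (Carrier × Word)

  coeff : A → Word → Carrier
  coeff []             w = 0#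
  coeff ((k , u) ∷ p) w with ≡-dec _≟ᶠ_ u w
  ... | yes _ = k + coeff p w
  ... | no  _ = coeff p w

  _≈A_ : A → A → Set ℓ
  p ≈A q = ∀ w → coeff p w ≈ coeff q w

  0A : A
  0A = []

  1A : A
  1A = (1# , []) ∷ []

  _+A_ : A → A → A
  p +A q = p ++ q

  _*A_ : A → A → A
  p *A q = concatMap (λ { (k , u) → map (λ { (l , v) → (k * l , u ++ v) }) q }) p

  gen : Fin n → A
  gen i = (1# , i ∷ []) ∷ []

  monomial : (Fin n → A) → Word → A
  monomial a []       = 1A
  monomial a (i ∷ w)  = a i *A monomial a w

  _·A_ : Carrier → A → A
  k ·A p = map (λ { (l , v) → (k * l , v) }) p

  evalAt : (Fin n → A) → A → A
  evalAt a []             = 0A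
  evalAt a ((k , w) ∷ p) = (k ·A monomial a w) +A evalAt a p

  -- The monomials in a_1,…,a_n (words w ↦ w(a)) are K-linearly
  -- independent: a formal combination vanishing at a is trivial.
  -- (This also forces the a_i and the monomials w(a) to be pairwise
  -- distinct, i.e. the family is indexed injectively.)
  MonomialsIndependent : (Fin n → A) → Set (c ⊔ ℓ)
  MonomialsIndependent a = ∀ p → evalAt a p ≈A 0A → p ≈A 0A

  MonomialsSpan : (Fin n → A) → Set (c ⊔ ℓ)
  MonomialsSpan a = ∀ q → Σ A λ p → evalAt a p ≈A q

  IsFreeBasis : (Fin n → A) → Set (c ⊔ ℓ)
  IsFreeBasis a = MonomialsIndependent a × MonomialsSpan a

-- First-order logic in the language of rings {+, ·, 0, 1}, with
-- well-scoped variables (Fin m).  No constants other than 0, 1, so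
-- formulas are parameter-free.

data Term (m : ℕ) : Set where
  var      : Fin m → Term m
  𝟘 𝟙      : Term m
  _⊕_ _⊗_  : Term m → Term m → Term m

data Formula : ℕ → Set where
  _≐_          : ∀ {m} → Term m → Term m → Formula m
  ⊥f           : ∀ {m} → Formula m
  ¬f_          : ∀ {m} → Formula m → Formula m
  _∧f_ _∨f_ _⇒f_ : ∀ {m} → Formula m → Formula m → Formula m
  ∀f ∃f        : ∀ {m} → Formula (suc m) → Formula m

record RingLangStructure (a ℓ : Level) : Set (lsuc (a ⊔ ℓ)) where
  field
    Carrier : Set a
    _≈_     : Carrier → Carrier → Set ℓ
    _+_ _*_ : Carrier → Carrier → Carrier
    0# 1#   : Carrier

module Semantics {a ℓ : Level} (M : RingLangStructure a ℓ) where
  open RingLangStructure M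

  extend : ∀ {m} → Carrier → (Fin m → Carrier) → Fin (suc m) → Carrier
  extend x ρ Fin.zero    = x
  extend x ρ (Fin.suc i) = ρ i

  ⟦_⟧t : ∀ {m} → Term m → (Fin m → Carrier) → Carrier
  ⟦ var i ⟧t ρ = ρ i
  ⟦ 𝟘 ⟧t     ρ = 0#
  ⟦ 𝟙 ⟧t     ρ = 1#
  ⟦ s ⊕ t ⟧t ρ = ⟦ s ⟧t ρ + ⟦ t ⟧t ρ
  ⟦ s ⊗ t ⟧t ρ = ⟦ s ⟧t ρ * ⟦ t ⟧t ρ

  ⊨_[_] : ∀ {m} → Formula m → (Fin m → Carrier) → Set (a ⊔ ℓ)
  ⊨ (s ≐ t)   [ ρ ] = Level.Lift (a ⊔ ℓ) (⟦ s ⟧t ρ ≈ ⟦ t ⟧t ρ)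
  ⊨ ⊥f        [ ρ ] = Level.Lift (a ⊔ ℓ) ⊥
  ⊨ (¬f φ)    [ ρ ] = ¬ (⊨ φ [ ρ ])
  ⊨ (φ ∧f ψ)  [ ρ ] = (⊨ φ [ ρ ]) × (⊨ ψ [ ρ ])
  ⊨ (φ ∨f ψ)  [ ρ ] = (⊨ φ [ ρ ]) ⊎ (⊨ ψ [ ρ ])
  ⊨ (φ ⇒f ψ)  [ ρ ] = (⊨ φ [ ρ ]) → (⊨ ψ [ ρ ])
  ⊨ (∀f φ)    [ ρ ] = ∀ x → ⊨ φ [ extend x ρ ]
  ⊨ (∃f φ)    [ ρ ] = Σ Carrier λ x → ⊨ φ [ extend x ρ ]

𝔸 : ∀ {c ℓ} → Field c ℓ → ℕ → RingLangStructure c ℓ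
𝔸 K n = record
  { Carrier = A ; _≈_ = _≈A_ ; _+_ = _+A_ ; _*_ = _*A_ ; 0# = 0A ; 1# = 1A }
  where open FreeAlgebra K n

{-# OPTIONS --safe #-}
module Submission where

-- Equality in K is not assumed decidable, so the defining formulas are kept equational.
--
-- Rank n ≥ 2.  A family a spans iff every b is coded: for all s and t, with x_i = t sⁱ, there is
-- a D such that for every y there are G_i with  b y + Σ G_i x_i = y D + Σ a_i G_i.  If
-- b = Σ c_w w(a), then D = Σ c_w w(x) works.  Conversely take for the x_i long words Y Xᵏ and for
-- y = Y Xᴹ a word which is even longer than D.  Comparing coefficients of words ending in y w(x)
-- yields a tree of equations b_w = c_w + Σ a_i b_{wi} with root b, and it is finite because the
-- G_i have finite degree; so b is a polynomial in a.  A spanning family is a basis iff the right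
-- ideals a_i A form a direct sum and the a_i can be cancelled on the right.
--
-- Rank 1.  With λ and c ranging over K, a spans iff for every x there is a D such that for every
-- λ some c satisfies x ≡ c mod (a - λ) and D ≡ c mod (x - λ): for x the generator and λ = a(κ),
-- this gives κ = D(a(κ)) for every κ in the infinite field K, so x = D(a).  The constants are
-- defined as the sums of two units.  In the absence of decidable equality units need only be
-- constant up to nilpotents, so κ - D(a(κ)) is only nilpotent, and Nakayama's lemma concludes.

open import Defs
open import Level using (Level; _⊔_; Lift; lift; lower)
open import Algebra.Bundles using (Ring; CommutativeRing)
open import Data.Nat as ℕ using (ℕ; zero; suc; _≤_; _<_; z≤n; s≤s)
import Data.Nat.Properties as ℕ
open import Data.Fin using (Fin; #_; zero; suc; toℕ; _↑ˡ_; _↑ʳ_)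
open import Data.Fin.Properties using (toℕ<n; toℕ-injective) renaming (_≟_ to _≟ᶠ_)
open import Data.List using (List; []; _∷_; _++_; map; length; deduplicate; replicate)
open import Data.List.Properties
  using (≡-dec; ++-assoc; ++-identityʳ; ++-cancelˡ; ++-cancelʳ; length-++; length-replicate; ∷-injective)
open import Data.List.Membership.Propositional using (_∈_)
open import Data.List.Membership.Propositional.Properties using (∈-deduplicate⁺; ∈-map⁺)
open import Data.List.Relation.Unary.All as All using (All; []; _∷_)
import Data.List.Relation.Unary.All.Properties as All
open import Data.List.Relation.Unary.AllPairs using ([]; _∷_)
open import Data.List.Relation.Unary.Any using (here; there)
open import Data.List.Relation.Unary.Unique.Propositional using (Unique)
open import Data.List.Relation.Unary.Unique.DecPropositional.Properties using (deduplicate-!)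
open import Data.Vec as Vec using (Vec; []; _∷_; lookup)
open import Data.Vec.Properties using (lookup∘tabulate)
open import Data.Product using (Σ; ∃; _×_; _,_; proj₁; proj₂)
open import Data.Sum using (_⊎_; inj₁; inj₂)
open import Data.Empty using (⊥-elim)
open import Data.Unit using (⊤; tt)
open import Function using (_∘_)
open import Function.Bundles using (_⇔_; mk⇔; Equivalence)
open import Relation.Binary.Definitions using (tri<; tri≈; tri>)
open import Relation.Binary.PropositionalEquality as ≡ using (_≡_; _≢_)
open import Relation.Nullary using (¬_; yes; no; Dec)
import Algebra.Properties.CommutativeSemigroup as CommutativeSemigroupProperties
import Algebra.Properties.CommutativeSemiring.Exp as CommutativeSemiringExp
import Algebra.Properties.Ring as RingProperties
import Algebra.Properties.Semiring.Exp as SemiringExp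
import Algebra.Properties.Semiring.Sum as SemiringSum
import Relation.Binary.Reasoning.Setoid as SetoidReasoning

-- The coding equation telescopes: `w(a) y` becomes `y w(x)` when the letters are taken one by one
-- from the left end, where they read `a_i`, to the right end, where they read `x_i`; the `G_i`
-- collect what stands in between. The converse rests on the order of the quantifiers. `D` depends
-- on the `x_i` but not on `y`, so the `x_i` can be made long compared with the degrees of `a`, and
-- afterwards `y` long compared with the degree of `D`. Words of the form `Y Xᵏ` need two letters,
-- so rank 1 has to use something else: there the ring is commutative, and its units single out the
-- constants.
--
-- In `K` only an element with `¬ x ≈ 0` has an inverse. A nilpotent element is therefore known not
-- to be nonzero, but not known to be zero, and leading coefficients cannot be located. Hence all
-- degrees are upper bounds read off the list of terms, and nilpotents have to be carried along in
-- rank 1.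

-- Linear functionals on formal combinations, and the ring laws.

module Functionals {c ℓ : Level} (K : Field c ℓ) (n : ℕ) where
  open Field K hiding (zero)
  open FreeAlgebra K n renaming (_*A_ to infixl 7 _*A_; _+A_ to infixl 6 _+A_)
  open CommutativeSemigroupProperties +-commutativeSemigroup using (interchange; x∙yz≈y∙xz)
  open SetoidReasoning setoid

  private
    _≟ʷ_ : (u w : Word) → Dec (u ≡ w)
    _≟ʷ_ = ≡-dec _≟ᶠ_

    variable
      f g : Word → Carrier

  infix 5 ⟨_,_⟩
  -- The linear extension of `f` from words to combinations. It works on the raw list of terms, so
  -- sums, products and evaluations become nested pairings, and equal words are collected only where
  -- coefficients are compared.
  ⟨_,_⟩ : A → (Word → Carrier) → Carrier
  ⟨ [] , f ⟩          = 0#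
  ⟨ (k , w) ∷ p , f ⟩ = k * f w + ⟨ p , f ⟩

  ⟨⟩-cong : ∀ p → (∀ w → f w ≈ g w) → ⟨ p , f ⟩ ≈ ⟨ p , g ⟩
  ⟨⟩-cong []            f≈g = refl
  ⟨⟩-cong ((k , w) ∷ p) f≈g = +-cong (*-congˡ (f≈g w)) (⟨⟩-cong p f≈g)

  ⟨⟩-++ : ∀ p q → ⟨ p ++ q , f ⟩ ≈ ⟨ p , f ⟩ + ⟨ q , f ⟩
  ⟨⟩-++ []      q = sym (+-identityˡ _)
  ⟨⟩-++ (_ ∷ p) q = trans (+-congˡ (⟨⟩-++ p q)) (sym (+-assoc _ _ _))

  ⟨⟩-0 : ∀ p → ⟨ p , (λ _ → 0#) ⟩ ≈ 0#
  ⟨⟩-0 []      = refl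
  ⟨⟩-0 (_ ∷ p) = trans (+-cong (zeroʳ _) (⟨⟩-0 p)) (+-identityˡ 0#)

  ⟨⟩-+ : ∀ p → ⟨ p , (λ w → f w + g w) ⟩ ≈ ⟨ p , f ⟩ + ⟨ p , g ⟩
  ⟨⟩-+ []      = sym (+-identityˡ 0#)
  ⟨⟩-+ (_ ∷ p) = trans (+-cong (distribˡ _ _ _) (⟨⟩-+ p)) (interchange _ _ _ _)

  ⟨⟩-*ʳ : ∀ p k → ⟨ p , (λ w → f w * k) ⟩ ≈ ⟨ p , f ⟩ * k
  ⟨⟩-*ʳ []      k = sym (zeroˡ k)
  ⟨⟩-*ʳ (_ ∷ p) k = trans (+-cong (sym (*-assoc _ _ _)) (⟨⟩-*ʳ p k)) (sym (distribʳ _ _ _))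

  ⟨⟩-*ˡ : ∀ p k → ⟨ p , (λ w → k * f w) ⟩ ≈ k * ⟨ p , f ⟩
  ⟨⟩-*ˡ p k = trans (⟨⟩-cong p (λ _ → *-comm _ _)) (trans (⟨⟩-*ʳ p k) (*-comm _ _))

  ⟨⟩-swap : ∀ (h : Word → Word → Carrier) p q →
            ⟨ p , (λ u → ⟨ q , h u ⟩) ⟩ ≈ ⟨ q , (λ v → ⟨ p , (λ u → h u v) ⟩) ⟩
  ⟨⟩-swap h []            q = sym (⟨⟩-0 q)
  ⟨⟩-swap h ((k , u) ∷ p) q =
    trans (+-cong (sym (⟨⟩-*ˡ q k)) (⟨⟩-swap h p q)) (sym (⟨⟩-+ q))

  ⟨⟩-map : ∀ k (_▹_ : Word → Word) (φ : Carrier × Word → Carrier × Word) →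
           (∀ l v → φ (l , v) ≡ (k * l , _▹_ v)) →
           ∀ q → ⟨ map φ q , f ⟩ ≈ k * ⟨ q , (λ v → f (_▹_ v)) ⟩
  ⟨⟩-map k _▹_ φ eq []            = sym (zeroʳ k)
  ⟨⟩-map k _▹_ φ eq ((l , v) ∷ q) rewrite eq l v =
    trans (+-cong (*-assoc _ _ _) (⟨⟩-map k _▹_ φ eq q)) (sym (distribˡ _ _ _))

  ⟨⟩-· : ∀ k p → ⟨ k ·A p , f ⟩ ≈ k * ⟨ p , f ⟩
  ⟨⟩-· k p = ⟨⟩-map k (λ v → v) _ (λ _ _ → ≡.refl) p

  ⟨⟩-* : ∀ p q → ⟨ p *A q , f ⟩ ≈ ⟨ p , (λ u → ⟨ q , (λ v → f (u ++ v)) ⟩) ⟩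
  ⟨⟩-* []            q = refl
  ⟨⟩-* ((k , u) ∷ p) q =
    trans (⟨⟩-++ (map (λ (l , v) → (k * l , u ++ v)) q) (p *A q))
          (+-cong (⟨⟩-map k (u ++_) _ (λ _ _ → ≡.refl) q) (⟨⟩-* p q))

  ⟨⟩-eval : ∀ a p → ⟨ evalAt a p , f ⟩ ≈ ⟨ p , (λ w → ⟨ monomial a w , f ⟩) ⟩
  ⟨⟩-eval a []            = refl
  ⟨⟩-eval a ((k , w) ∷ p) =
    trans (⟨⟩-++ (k ·A monomial a w) _) (+-cong (⟨⟩-· k (monomial a w)) (⟨⟩-eval a p))

  δ : Word → Word → Carrier
  δ w u with u ≟ʷ w
  ... | yes _ = 1#
  ... | no  _ = 0#

  δ-refl : ∀ {u w} → u ≡ w → δ w u ≈ 1#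
  δ-refl {u} {w} eq with u ≟ʷ w
  ... | yes _   = refl
  ... | no  neq = ⊥-elim (neq eq)

  δ-≢ : ∀ {u w} → u ≢ w → δ w u ≈ 0#
  δ-≢ {u} {w} neq with u ≟ʷ w
  ... | yes eq = ⊥-elim (neq eq)
  ... | no  _  = refl

  δ-inj : ∀ (φ : Word → Word) {u w} → (∀ {x y} → φ x ≡ φ y → x ≡ y) → δ (φ w) (φ u) ≈ δ w u
  δ-inj φ {u} {w} inj with u ≟ʷ w
  ... | yes eq  = δ-refl (≡.cong φ eq)
  ... | no  neq = δ-≢ (neq ∘ inj)

  coeff-δ : ∀ p w → coeff p w ≈ ⟨ p , δ w ⟩
  coeff-δ []            w = refl
  coeff-δ ((k , u) ∷ p) w with u ≟ʷ w
  ... | yes _ = +-cong (sym (*-identityʳ k)) (coeff-δ p w)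
  ... | no  _ = trans (coeff-δ p w) (sym (trans (+-congʳ (zeroʳ k)) (+-identityˡ _)))

  collect : List Word → A → A
  collect W p = map (λ w → (coeff p w , w)) W

  private
    coeff-≢ : ∀ {k u w} p → u ≢ w → coeff ((k , u) ∷ p) w ≡ coeff p w
    coeff-≢ {u = u} {w} p neq with u ≟ʷ w
    ... | yes eq = ⊥-elim (neq eq)
    ... | no  _  = ≡.refl

    coeff-≡ : ∀ {k u} p → coeff ((k , u) ∷ p) u ≡ k + coeff p u
    coeff-≡ {u = u} p with u ≟ʷ u
    ... | yes _  = ≡.refl
    ... | no neq = ⊥-elim (neq ≡.refl)

    collect-∉ : ∀ {k u} W p → All (u ≢_) W → ⟨ collect W ((k , u) ∷ p) , f ⟩ ≈ ⟨ collect W p , f ⟩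
    collect-∉ []      p []        = refl
    collect-∉ (w ∷ W) p (px ∷ pxs) = +-cong (*-congʳ (reflexive (coeff-≢ p px))) (collect-∉ W p pxs)

    collect-∈ : ∀ {k u} W p → Unique W → u ∈ W →
                ⟨ collect W ((k , u) ∷ p) , f ⟩ ≈ k * f u + ⟨ collect W p , f ⟩
    collect-∈ (w ∷ W) p (w∉ ∷ _) (here ≡.refl) =
      trans (+-cong (trans (*-congʳ (reflexive (coeff-≡ p))) (distribʳ _ _ _)) (collect-∉ W p w∉))
            (+-assoc _ _ _)
    collect-∈ (w ∷ W) p (w∉ ∷ uW) (there u∈) =
      trans (+-cong (*-congʳ (reflexive (coeff-≢ p λ eq → All.lookup w∉ u∈ (≡.sym eq))))
                    (collect-∈ W p uW u∈))
            (x∙yz≈y∙xz _ _ _)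

    collect-[] : ∀ W → ⟨ collect W [] , f ⟩ ≈ 0#
    collect-[] []      = refl
    collect-[] (w ∷ W) = trans (+-cong (zeroˡ _) (collect-[] W)) (+-identityˡ 0#)

  -- Equality of words is decidable even where equality of scalars is not, so terms can be grouped
  -- by word. The list `W` may be larger than necessary: a word whose total coefficient is zero does
  -- no harm.
  ⟨⟩-collect : ∀ W p → Unique W → All (λ m → proj₂ m ∈ W) p → ⟨ p , f ⟩ ≈ ⟨ collect W p , f ⟩
  ⟨⟩-collect W []            uW []         = sym (collect-[] W)
  ⟨⟩-collect W ((k , u) ∷ p) uW (u∈ ∷ p∈) =
    trans (+-congˡ (⟨⟩-collect W p uW p∈)) (sym (collect-∈ W p uW u∈))

  support : A → List Word
  support p = deduplicate _≟ʷ_ (map proj₂ p)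

  support-unique : ∀ p → Unique (support p)
  support-unique p = deduplicate-! _≟ʷ_ (map proj₂ p)

  private
    ∈-support : ∀ p → All (λ m → proj₂ m ∈ support p) p
    ∈-support p = All.tabulate λ m∈ → ∈-deduplicate⁺ _≟ʷ_ (∈-map⁺ proj₂ m∈)

  ⟨⟩-normal : ∀ p → ⟨ p , f ⟩ ≈ ⟨ collect (support p) p , f ⟩
  ⟨⟩-normal p = ⟨⟩-collect (support p) p (support-unique p) (∈-support p)

  -- This allows words of coefficient zero to be ignored without deciding which words these are.
  -- Grouping comes first because the hypothesis concerns total coefficients, not those of single
  -- terms.
  ⟨⟩-cong-coeff : ∀ p → (∀ w → coeff p w * f w ≈ coeff p w * g w) → ⟨ p , f ⟩ ≈ ⟨ p , g ⟩
  ⟨⟩-cong-coeff {f} {g} p eq = trans (⟨⟩-normal p) (trans (go (support p)) (sym (⟨⟩-normal p)))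
    where
    go : ∀ W → ⟨ collect W p , f ⟩ ≈ ⟨ collect W p , g ⟩
    go []      = refl
    go (w ∷ W) = +-cong (eq w) (go W)

  infix 4 _≃_
  -- Testing against all functionals makes products compatible with equality at once, since the
  -- inner pairing in `⟨⟩-*` is again a functional. The record keeps `p` and `q` recoverable from
  -- the type.
  record _≃_ (p q : A) : Set (c ⊔ ℓ) where
    constructor by-functionals
    field functional : ∀ f → ⟨ p , f ⟩ ≈ ⟨ q , f ⟩
  open _≃_ public

  ≃⇒≈A : ∀ {p q} → p ≃ q → p ≈A q
  ≃⇒≈A {p} {q} p≃q w = trans (coeff-δ p w) (trans (functional p≃q (δ w)) (sym (coeff-δ q w)))

  -- Both sides are grouped along the same list, the words of `p ++ q`; then only the coefficients
  -- can differ.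
  ≈A⇒≃ : ∀ {p q} → p ≈A q → p ≃ q
  ≈A⇒≃ {p} {q} p≈q = by-functionals λ f →
    trans (⟨⟩-collect W p uW (All.++⁻ˡ p (∈-support (p ++ q))))
      (trans (go f W) (sym (⟨⟩-collect W q uW (All.++⁻ʳ p (∈-support (p ++ q))))))
    where
    W = support (p ++ q)
    uW = support-unique (p ++ q)
    go : ∀ f V → ⟨ collect V p , f ⟩ ≈ ⟨ collect V q , f ⟩
    go f []      = refl
    go f (w ∷ V) = +-cong (*-congʳ (p≈q w)) (go f V)

  normal≃ : ∀ p → p ≃ collect (support p) p
  normal≃ p = by-functionals λ _ → ⟨⟩-normal p

  infix 8 -A_
  -A_ : A → A
  -A p = (- 1#) ·A p

  private
    open RingProperties ring using (-1*x≈-x)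

    ·-inverseʳ : ∀ p → p +A (-A p) ≃ 0A
    ·-inverseʳ p = by-functionals λ f →
      trans (⟨⟩-++ p (-A p)) (trans (+-congˡ (trans (⟨⟩-· (- 1#) p) (-1*x≈-x _))) (-‿inverseʳ _))

    +A-comm : ∀ p q → p +A q ≃ q +A p
    +A-comm p q = by-functionals λ f →
      trans (⟨⟩-++ p q) (trans (+-comm _ _) (sym (⟨⟩-++ q p)))

    ≃-refl : ∀ {p} → p ≃ p
    ≃-refl = by-functionals λ _ → refl

    ≃-trans : ∀ {p q r} → p ≃ q → q ≃ r → p ≃ r
    ≃-trans p≃q q≃r = by-functionals λ f → trans (functional p≃q f) (functional q≃r f)

    ≃-reflexive : ∀ {p q} → p ≡ q → p ≃ q
    ≃-reflexive ≡.refl = ≃-refl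

    *A-cong : ∀ {p p′ q q′} → p ≃ p′ → q ≃ q′ → p *A q ≃ p′ *A q′
    *A-cong {p} {p′} {q} {q′} p≃ q≃ = by-functionals λ f →
      trans (⟨⟩-* p q) (trans (functional p≃ _)
        (trans (⟨⟩-cong p′ (λ u → functional q≃ _)) (sym (⟨⟩-* p′ q′))))

    *A-assoc : ∀ p q r → (p *A q) *A r ≃ p *A (q *A r)
    *A-assoc p q r = by-functionals λ f → begin
      ⟨ (p *A q) *A r , f ⟩                                                    ≈⟨ ⟨⟩-* (p *A q) r ⟩
      ⟨ p *A q , (λ u → ⟨ r , (λ v → f (u ++ v)) ⟩) ⟩                          ≈⟨ ⟨⟩-* p q ⟩
      ⟨ p , (λ u → ⟨ q , (λ v → ⟨ r , (λ w → f ((u ++ v) ++ w)) ⟩) ⟩) ⟩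
        ≈⟨ ⟨⟩-cong p (λ u → ⟨⟩-cong q λ v → ⟨⟩-cong r λ w → reflexive (≡.cong f (++-assoc u v w))) ⟩
      ⟨ p , (λ u → ⟨ q , (λ v → ⟨ r , (λ w → f (u ++ (v ++ w))) ⟩) ⟩) ⟩        ≈⟨ ⟨⟩-cong p (λ u → sym (⟨⟩-* q r)) ⟩
      ⟨ p , (λ u → ⟨ q *A r , (λ v → f (u ++ v)) ⟩) ⟩                          ≈⟨ ⟨⟩-* p (q *A r) ⟨
      ⟨ p *A (q *A r) , f ⟩                                                    ∎

    ⟨1⟩ : ∀ f → ⟨ 1A , f ⟩ ≈ f []
    ⟨1⟩ f = trans (+-identityʳ _) (*-identityˡ _)

    *A-identityˡ : ∀ p → 1A *A p ≃ p
    *A-identityˡ p = by-functionals λ f → trans (⟨⟩-* 1A p) (⟨1⟩ λ u → ⟨ p , (λ v → f (u ++ v)) ⟩)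

    *A-identityʳ : ∀ p → p *A 1A ≃ p
    *A-identityʳ p = by-functionals λ f → trans (⟨⟩-* p 1A)
      (⟨⟩-cong p λ u → trans (⟨1⟩ λ v → f (u ++ v)) (reflexive (≡.cong f (++-identityʳ u))))

    *A-distribˡ : ∀ p q r → p *A (q +A r) ≃ (p *A q) +A (p *A r)
    *A-distribˡ p q r = by-functionals λ f → begin
      ⟨ p *A (q +A r) , f ⟩                   ≈⟨ ⟨⟩-* p (q +A r) ⟩
      ⟨ p , (λ u → ⟨ q ++ r , (λ v → f (u ++ v)) ⟩) ⟩ ≈⟨ ⟨⟩-cong p (λ u → ⟨⟩-++ q r) ⟩
      ⟨ p , (λ u → ⟨ q , (λ v → f (u ++ v)) ⟩ + ⟨ r , (λ v → f (u ++ v)) ⟩) ⟩ ≈⟨ ⟨⟩-+ p ⟩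
      _ ≈⟨ +-cong (⟨⟩-* p q) (⟨⟩-* p r) ⟨
      _ ≈⟨ ⟨⟩-++ (p *A q) (p *A r) ⟨
      ⟨ (p *A q) +A (p *A r) , f ⟩ ∎

    *A-distribʳ : ∀ p q r → (q +A r) *A p ≃ (q *A p) +A (r *A p)
    *A-distribʳ p q r = by-functionals λ f →
      trans (⟨⟩-* (q +A r) p) (trans (⟨⟩-++ q r)
        (trans (+-cong (sym (⟨⟩-* q p)) (sym (⟨⟩-* r p))) (sym (⟨⟩-++ (q *A p) (r *A p)))))

  ring𝔸 : Ring c (c ⊔ ℓ)
  ring𝔸 = record
    { Carrier = A ; _≈_ = _≃_ ; _+_ = _+A_ ; _*_ = _*A_ ; -_ = -A_ ; 0# = 0A ; 1# = 1A
    ; isRing = record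
      { +-isAbelianGroup = record
        { isGroup = record
          { isMonoid = record
            { isSemigroup = record
              { isMagma = record
                { isEquivalence = record
                  { refl = ≃-refl
                  ; sym = λ p≃q → by-functionals λ f → sym (functional p≃q f)
                  ; trans = ≃-trans }
                ; ∙-cong = λ {p} {p′} {q} {q′} p≃ q≃ → by-functionals λ f →
                    trans (⟨⟩-++ p q) (trans (+-cong (functional p≃ f) (functional q≃ f)) (sym (⟨⟩-++ p′ q′))) }
              ; assoc = λ p q r → ≃-reflexive (++-assoc p q r) }
            ; identity = (λ _ → ≃-refl) , λ p → ≃-reflexive (++-identityʳ p) }
          ; inverse = (λ p → ≃-trans (+A-comm (-A p) p) (·-inverseʳ p)) , ·-inverseʳ
          ; ⁻¹-cong = λ {p} {q} p≃q → by-functionals λ f →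
              trans (⟨⟩-· (- 1#) p) (trans (*-congˡ (functional p≃q f)) (sym (⟨⟩-· (- 1#) q))) }
        ; comm = +A-comm }
      ; *-cong = *A-cong
      ; *-assoc = *A-assoc
      ; *-identity = *A-identityˡ , *A-identityʳ
      ; distrib = *A-distribˡ , *A-distribʳ } }

-- Evaluation as a ring homomorphism, and the subalgebra generated by a family.

module Evaluation {c ℓ : Level} (K : Field c ℓ) (n : ℕ) where
  open Field K hiding (zero)
  open FreeAlgebra K n renaming (_*A_ to infixl 7 _*A_; _+A_ to infixl 6 _+A_)
  open Functionals K n
  private module R = Ring ring𝔸
  open SetoidReasoning setoid

  scalar : Carrier → A
  scalar k = (k , []) ∷ []

  word : Word → A
  word w = (1# , w) ∷ []

  ⟨scalar⟩ : ∀ k f → ⟨ scalar k , f ⟩ ≈ k * f []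
  ⟨scalar⟩ k f = +-identityʳ _

  ⟨word⟩ : ∀ w f → ⟨ word w , f ⟩ ≈ f w
  ⟨word⟩ w f = trans (+-identityʳ _) (*-identityˡ _)

  scalar-cong : ∀ {k l} → k ≈ l → scalar k ≃ scalar l
  scalar-cong k≈l = by-functionals λ f → +-congʳ (*-congʳ k≈l)

  scalar-0 : scalar 0# ≃ 0A
  scalar-0 = by-functionals λ f → trans (⟨scalar⟩ 0# f) (zeroˡ _)

  scalar-* : ∀ k p → scalar k *A p ≃ k ·A p
  scalar-* k p = by-functionals λ f →
    trans (⟨⟩-* (scalar k) p) (trans (⟨scalar⟩ k λ u → ⟨ p , (λ v → f (u ++ v)) ⟩) (sym (⟨⟩-· {f = f} k p)))

  scalar-central : ∀ k p → scalar k *A p ≃ p *A scalar k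
  scalar-central k p = by-functionals λ f → begin
    ⟨ scalar k *A p , f ⟩ ≈⟨ functional (scalar-* k p) f ⟩
    ⟨ k ·A p , f ⟩ ≈⟨ ⟨⟩-· k p ⟩
    k * ⟨ p , f ⟩ ≈⟨ ⟨⟩-*ˡ p k ⟨
    ⟨ p , (λ u → k * f u) ⟩
      ≈⟨ ⟨⟩-cong p (λ u → trans (⟨scalar⟩ k λ v → f (u ++ v)) (*-congˡ (reflexive (≡.cong f (++-identityʳ u))))) ⟨
    ⟨ p , (λ u → ⟨ scalar k , (λ v → f (u ++ v)) ⟩) ⟩ ≈⟨ ⟨⟩-* p (scalar k) ⟨
    ⟨ p *A scalar k , f ⟩ ∎

  module _ (a : Fin n → A) where

    monomial-++ : ∀ u v → monomial a (u ++ v) ≃ monomial a u *A monomial a v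
    monomial-++ []      v = R.sym (R.*-identityˡ _)
    monomial-++ (i ∷ u) v = R.trans (R.*-congˡ {a i} (monomial-++ u v)) (R.sym (R.*-assoc (a i) _ _))

    eval-cong : ∀ {p q} → p ≃ q → evalAt a p ≃ evalAt a q
    eval-cong {p} {q} p≃q = by-functionals λ f →
      trans (⟨⟩-eval a p) (trans (functional p≃q _) (sym (⟨⟩-eval a q)))

    eval-+ : ∀ p q → evalAt a (p +A q) ≃ evalAt a p +A evalAt a q
    eval-+ p q = by-functionals λ f →
      trans (⟨⟩-eval a (p ++ q)) (trans (⟨⟩-++ p q)
        (trans (+-cong (sym (⟨⟩-eval a p)) (sym (⟨⟩-eval a q))) (sym (⟨⟩-++ (evalAt a p) _))))

    eval-word : ∀ w → evalAt a (word w) ≃ monomial a w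
    eval-word w = by-functionals λ f → trans (⟨⟩-eval a (word w)) (⟨word⟩ w λ u → ⟨ monomial a u , f ⟩)

    eval-gen : ∀ i → evalAt a (gen i) ≃ a i
    eval-gen i = R.trans (eval-word (i ∷ [])) (R.*-identityʳ (a i))

    eval-scalar : ∀ k → evalAt a (scalar k) ≃ scalar k
    eval-scalar k = by-functionals λ f →
      trans (⟨⟩-eval {f = f} a (scalar k)) (trans (⟨scalar⟩ k λ u → ⟨ monomial a u , f ⟩)
        (trans (*-congˡ (⟨word⟩ [] f)) (sym (⟨scalar⟩ k f))))

    eval-* : ∀ p q → evalAt a (p *A q) ≃ evalAt a p *A evalAt a q
    eval-* p q = by-functionals λ f → begin
      ⟨ evalAt a (p *A q) , f ⟩
        ≈⟨ ⟨⟩-eval a (p *A q) ⟩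
      ⟨ p *A q , (λ w → ⟨ monomial a w , f ⟩) ⟩
        ≈⟨ ⟨⟩-* p q ⟩
      ⟨ p , (λ u → ⟨ q , (λ v → ⟨ monomial a (u ++ v) , f ⟩) ⟩) ⟩
        ≈⟨ ⟨⟩-cong p (λ u → ⟨⟩-cong q λ v → trans (functional (monomial-++ u v) f)
            (⟨⟩-* (monomial a u) (monomial a v))) ⟩
      ⟨ p , (λ u → ⟨ q , (λ v → ⟨ monomial a u , (λ x → ⟨ monomial a v , (λ y → f (x ++ y)) ⟩) ⟩) ⟩) ⟩
        ≈⟨ ⟨⟩-cong p (λ u → ⟨⟩-swap _ q (monomial a u)) ⟩
      ⟨ p , (λ u → ⟨ monomial a u , (λ x → ⟨ q , (λ v → ⟨ monomial a v , (λ y → f (x ++ y)) ⟩) ⟩) ⟩) ⟩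
        ≈⟨ ⟨⟩-cong p (λ u → ⟨⟩-cong (monomial a u) λ x → ⟨⟩-eval a q) ⟨
      ⟨ p , (λ u → ⟨ monomial a u , (λ x → ⟨ evalAt a q , (λ y → f (x ++ y)) ⟩) ⟩) ⟩
        ≈⟨ ⟨⟩-eval a p ⟨
      ⟨ evalAt a p , (λ x → ⟨ evalAt a q , (λ y → f (x ++ y)) ⟩) ⟩
        ≈⟨ ⟨⟩-* (evalAt a p) (evalAt a q) ⟨
      ⟨ evalAt a p *A evalAt a q , f ⟩ ∎

    InSpan : A → Set (c ⊔ ℓ)
    InSpan b = Σ A λ p → evalAt a p ≃ b

    InSpan-resp : ∀ {b b′} → b ≃ b′ → InSpan b → InSpan b′
    InSpan-resp b≃b′ (p , eq) = p , R.trans eq b≃b′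

    InSpan-scalar : ∀ k → InSpan (scalar k)
    InSpan-scalar k = scalar k , eval-scalar k

    InSpan-gen : ∀ i → InSpan (a i)
    InSpan-gen i = gen i , eval-gen i

    InSpan-+ : ∀ {b b′} → InSpan b → InSpan b′ → InSpan (b +A b′)
    InSpan-+ (p , eq) (q , eq′) = p +A q , R.trans (eval-+ p q) (R.+-cong eq eq′)

    InSpan-* : ∀ {b b′} → InSpan b → InSpan b′ → InSpan (b *A b′)
    InSpan-* (p , eq) (q , eq′) = p *A q , R.trans (eval-* p q) (R.*-cong eq eq′)

    InSpan-sum : ∀ {m} {b : Fin m → A} → (∀ i → InSpan (b i)) → InSpan (SemiringSum.sum R.semiring b)
    InSpan-sum {zero}  bs = 0A , R.refl
    InSpan-sum {suc m} {b} bs = InSpan-+ {b zero} (bs zero) (InSpan-sum (bs ∘ suc))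

    -- Only left multiplication by scalars and by the `a i` is demanded, so `P` need not be closed
    -- under products.
    span-induction : ∀ {s} (P : A → Set s) → (∀ {b b′} → b ≃ b′ → P b → P b′) →
                     P 0A → P 1A → (∀ {b b′} → P b → P b′ → P (b +A b′)) →
                     (∀ k {b} → P b → P (scalar k *A b)) → (∀ i {b} → P b → P (a i *A b)) →
                     ∀ p → P (evalAt a p)
    span-induction P resp P0 P1 P+ Pk Pa = go
      where
      go-monomial : ∀ w → P (monomial a w)
      go-monomial []      = P1
      go-monomial (i ∷ w) = Pa i (go-monomial w)
      go : ∀ p → P (evalAt a p)
      go []            = P0
      go ((k , w) ∷ p) = P+ (resp (scalar-* k (monomial a w)) (Pk k (go-monomial w))) (go p)

-- Formula combinators and their meaning.

module Syntax where
  ∃* ∀* : ∀ k {m} → Formula (k ℕ.+ m) → Formula m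
  ∃* zero    φ = φ
  ∃* (suc k) φ = ∃* k (∃f φ)
  ∀* zero    φ = φ
  ∀* (suc k) φ = ∀* k (∀f φ)

  sumT : ∀ {m} k → (Fin k → Term m) → Term m
  sumT zero    t = 𝟘
  sumT (suc k) t = t zero ⊕ sumT k (t ∘ suc)

  powT : ∀ {m} → Term m → ℕ → Term m
  powT t zero    = 𝟙
  powT t (suc k) = t ⊗ powT t k

  ⋀ : ∀ {m} k → (Fin k → Formula m) → Formula m
  ⋀ zero    φ = 𝟘 ≐ 𝟘
  ⋀ (suc k) φ = φ zero ∧f ⋀ k (φ ∘ suc)

module SemanticsLemmas {c ℓ : Level} (K : Field c ℓ) (n : ℕ) where
  open FreeAlgebra K n renaming (_*A_ to infixl 7 _*A_; _+A_ to infixl 6 _+A_)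
  open Functionals K n
  open Syntax
  open Semantics (𝔸 K n)
  open SemiringSum (Ring.semiring ring𝔸) using (sum)
  open SemiringExp (Ring.semiring ring𝔸) using (_^_)

  extends : ∀ {k m} → Vec A k → (Fin m → A) → Fin (k ℕ.+ m) → A
  extends []      ρ = ρ
  extends (x ∷ v) ρ = extend x (extends v ρ)

  extends-↑ˡ : ∀ {k m} (v : Vec A k) (ρ : Fin m → A) i → extends v ρ (i ↑ˡ m) ≡ lookup v i
  extends-↑ˡ (x ∷ v) ρ zero    = ≡.refl
  extends-↑ˡ (x ∷ v) ρ (suc i) = extends-↑ˡ v ρ i

  extends-↑ʳ : ∀ {k m} (v : Vec A k) (ρ : Fin m → A) j → extends v ρ (k ↑ʳ j) ≡ ρ j
  extends-↑ʳ []      ρ j = ≡.refl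
  extends-↑ʳ (x ∷ v) ρ j = extends-↑ʳ v ρ j

  ⊨∃* : ∀ k {m} (φ : Formula (k ℕ.+ m)) ρ → (⊨ ∃* k φ [ ρ ]) ⇔ (Σ (Vec A k) λ v → ⊨ φ [ extends v ρ ])
  ⊨∃* zero    φ ρ = mk⇔ (λ h → [] , h) (λ { ([] , h) → h })
  ⊨∃* (suc k) φ ρ =
    mk⇔ (λ h → let (v , x , h′) = Equivalence.to (⊨∃* k (∃f φ) ρ) h in x ∷ v , h′)
        (λ { (x ∷ v , h) → Equivalence.from (⊨∃* k (∃f φ) ρ) (v , x , h) })

  ⊨∀* : ∀ k {m} (φ : Formula (k ℕ.+ m)) ρ → (⊨ ∀* k φ [ ρ ]) ⇔ ((v : Vec A k) → ⊨ φ [ extends v ρ ])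
  ⊨∀* zero    φ ρ = mk⇔ (λ { h [] → h }) (λ h → h [])
  ⊨∀* (suc k) φ ρ =
    mk⇔ (λ { h (x ∷ v) → Equivalence.to (⊨∀* k (∀f φ) ρ) h v x })
        (λ h → Equivalence.from (⊨∀* k (∀f φ) ρ) λ v x → h (x ∷ v))

  ⟦sumT⟧ : ∀ k {m} (t : Fin k → Term m) ρ → ⟦ sumT k t ⟧t ρ ≡ sum (λ i → ⟦ t i ⟧t ρ)
  ⟦sumT⟧ zero    t ρ = ≡.refl
  ⟦sumT⟧ (suc k) t ρ = ≡.cong (⟦ t zero ⟧t ρ +A_) (⟦sumT⟧ k (t ∘ suc) ρ)

  ⟦powT⟧ : ∀ k {m} (t : Term m) ρ → ⟦ powT t k ⟧t ρ ≡ ⟦ t ⟧t ρ ^ k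
  ⟦powT⟧ zero    t ρ = ≡.refl
  ⟦powT⟧ (suc k) t ρ = ≡.cong (⟦ t ⟧t ρ *A_) (⟦powT⟧ k t ρ)

  ⊨⋀ : ∀ k {m} (φ : Fin k → Formula m) ρ → (⊨ ⋀ k φ [ ρ ]) ⇔ (∀ i → ⊨ φ i [ ρ ])
  ⊨⋀ zero    φ ρ = mk⇔ (λ _ ()) (λ _ → lift λ _ → Field.refl K)
  ⊨⋀ (suc k) φ ρ =
    mk⇔ (λ { (h , hs) zero → h ; (h , hs) (suc i) → Equivalence.to (⊨⋀ k (φ ∘ suc) ρ) hs i })
        (λ h → h zero , Equivalence.from (⊨⋀ k (φ ∘ suc) ρ) (h ∘ suc))

-- Finite sums in a ring.

module SumLemmas {r ℓ : Level} (R : Ring r ℓ) where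
  open Ring R hiding (zero)
  open SemiringSum semiring

  sum-zero : ∀ {m} {f : Fin m → Carrier} → (∀ i → f i ≈ 0#) → sum f ≈ 0#
  sum-zero {m} f≈0 = trans (sum-cong-≋ f≈0) (sum-replicate-zero m)

  sum-single : ∀ {m} {f : Fin m → Carrier} j → (∀ i → i ≢ j → f i ≈ 0#) → sum f ≈ f j
  sum-single zero    f≈0 = trans (+-congˡ (sum-zero λ i → f≈0 (suc i) λ ())) (+-identityʳ _)
  sum-single (suc j) f≈0 =
    trans (+-cong (f≈0 zero λ ()) (sum-single j λ i i≢j → f≈0 (suc i) λ { ≡.refl → i≢j ≡.refl })) (+-identityˡ _)

  at : ∀ {m} → Fin m → Carrier → Fin m → Carrier
  at j z i with i ≟ᶠ j
  ... | yes _ = z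
  ... | no  _ = 0#

  at-≡ : ∀ {m} (j : Fin m) z → at j z j ≈ z
  at-≡ j z with j ≟ᶠ j
  ... | yes _   = refl
  ... | no  j≢j = ⊥-elim (j≢j ≡.refl)

  at-≢ : ∀ {m} {i j : Fin m} z → i ≢ j → at j z i ≈ 0#
  at-≢ {i = i} {j} z i≢j with i ≟ᶠ j
  ... | yes i≡j = ⊥-elim (i≢j i≡j)
  ... | no  _   = refl

  sum-at-* : ∀ {m} (f : Fin m → Carrier) j z → sum (λ i → f i * at j z i) ≈ f j * z
  sum-at-* f j z = trans (sum-single j λ i i≢j → trans (*-congˡ (at-≢ z i≢j)) (zeroʳ _)) (*-congˡ (at-≡ j z))

  sum-*-at : ∀ {m} (f : Fin m → Carrier) j z → sum (λ i → at j z i * f i) ≈ z * f j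
  sum-*-at f j z = trans (sum-single j λ i i≢j → trans (*-congʳ (at-≢ z i≢j)) (zeroˡ _)) (*-congʳ (at-≡ j z))

-- The coding equation and its closure properties.

module Coding {r ℓ : Level} (R : Ring r ℓ) {n : ℕ} (a : Fin n → Ring.Carrier R) where
  open Ring R hiding (zero)
  open SemiringSum semiring
  open SemiringExp semiring using (_^_)
  open SumLemmas R
  open CommutativeSemigroupProperties +-commutativeSemigroup using (interchange; x∙yz≈y∙xz)
  open SetoidReasoning setoid

  letter : Carrier → Carrier → Fin n → Carrier
  letter s t i = t * s ^ toℕ i

  -- The relation `b y - y D = Σ (a_i G_i - G_i x_i)` without subtraction, which the language of
  -- rings does not have.
  CodeEq : (b s t D y : Carrier) → (Fin n → Carrier) → Set ℓ
  CodeEq b s t D y G = b * y + sum (λ i → G i * letter s t i) ≈ y * D + sum (λ i → a i * G i)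

  Coded : Carrier → Set (r ⊔ ℓ)
  Coded b = ∀ s t → Σ Carrier λ D → ∀ y → Σ (Fin n → Carrier) (CodeEq b s t D y)

  coded-resp : ∀ {b b′} → b ≈ b′ → Coded b → Coded b′
  coded-resp b≈b′ cb s t = let (D , h) = cb s t in D , λ y → let (G , eq) = h y in
    G , trans (+-congʳ (*-congʳ (sym b≈b′))) eq

  coded-0 : Coded 0#
  coded-0 s t = 0# , λ y → (λ _ → 0#) ,
    +-cong (trans (zeroˡ y) (sym (zeroʳ y)))
           (trans (sum-zero {n} λ _ → zeroˡ _) (sym (sum-zero {n} λ _ → zeroʳ _)))

  coded-1 : Coded 1#
  coded-1 s t = 1# , λ y → (λ _ → 0#) ,
    +-cong (trans (*-identityˡ y) (sym (*-identityʳ y)))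
           (trans (sum-zero {n} λ _ → zeroˡ _) (sym (sum-zero {n} λ _ → zeroʳ _)))

  coded-+ : ∀ {b b′} → Coded b → Coded b′ → Coded (b + b′)
  coded-+ {b} {b′} cb cb′ s t =
    let (D , h) = cb s t ; (D′ , h′) = cb′ s t in D + D′ , λ y →
    let (G , eq) = h y ; (G′ , eq′) = h′ y in (λ i → G i + G′ i) , (begin
      (b + b′) * y + sum (λ i → (G i + G′ i) * letter s t i)
        ≈⟨ +-cong (distribʳ y b b′) (trans (sum-cong-≋ {n} λ i → distribʳ _ _ _) (∑-distrib-+ {n} _ _)) ⟩
      _ ≈⟨ interchange _ _ _ _ ⟩
      _ ≈⟨ +-cong eq eq′ ⟩
      _ ≈⟨ interchange _ _ _ _ ⟩
      _ ≈⟨ +-cong (distribˡ y D D′) (trans (sum-cong-≋ {n} λ i → distribˡ _ _ _) (∑-distrib-+ {n} _ _)) ⟨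
      y * (D + D′) + sum (λ i → a i * (G i + G′ i)) ∎)

  coded-central : ∀ k {b} → (∀ z → k * z ≈ z * k) → Coded b → Coded (k * b)
  coded-central k {b} central cb s t =
    let (D , h) = cb s t in k * D , λ y → let (G , eq) = h y in (λ i → k * G i) , (begin
      k * b * y + sum (λ i → k * G i * letter s t i)
        ≈⟨ +-cong (*-assoc k b y) (sum-cong-≋ {n} λ i → *-assoc k (G i) _) ⟩
      k * (b * y) + sum (λ i → k * (G i * letter s t i))
        ≈⟨ +-congˡ (*-distribˡ-sum k λ i → G i * letter s t i) ⟨
      k * (b * y) + k * sum (λ i → G i * letter s t i) ≈⟨ distribˡ k _ _ ⟨
      k * (b * y + sum (λ i → G i * letter s t i)) ≈⟨ *-congˡ eq ⟩
      k * (y * D + sum (λ i → a i * G i)) ≈⟨ distribˡ k _ _ ⟩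
      k * (y * D) + k * sum (λ i → a i * G i)
        ≈⟨ +-cong (move y D) (trans (*-distribˡ-sum k λ i → a i * G i) (sum-cong-≋ {n} λ i → move (a i) (G i))) ⟩
      y * (k * D) + sum (λ i → a i * (k * G i)) ∎)
    where
    move : ∀ u v → k * (u * v) ≈ u * (k * v)
    move u v = trans (sym (*-assoc k u v)) (trans (*-congʳ (central u)) (*-assoc u k v))

  -- The hypothesis is used at `y x_j` in place of `y`. The extra summand `b y` of `G j` produces
  -- `a_j b y` on the right, matching the new left-hand term, and `b y x_j` on the left, which is
  -- what the instance at `y x_j` starts with.
  coded-* : ∀ j {b} → Coded b → Coded (a j * b)
  coded-* j {b} cb s t =
    let (D , h) = cb s t ; x = letter s t in x j * D , λ y →
    let (H , eq) = h (y * x j) in (λ i → H i + at j (b * y) i) , (begin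
      a j * b * y + sum (λ i → (H i + at j (b * y) i) * x i)
        ≈⟨ +-cong (*-assoc _ _ _) (trans (sum-cong-≋ {n} λ i → distribʳ _ _ _) (∑-distrib-+ {n} _ _)) ⟩
      a j * (b * y) + (sum (λ i → H i * x i) + sum (λ i → at j (b * y) i * x i))
        ≈⟨ +-congˡ (trans (+-congˡ (trans (sum-*-at x j (b * y)) (*-assoc _ _ _))) (+-comm _ _)) ⟩
      a j * (b * y) + (b * (y * x j) + sum (λ i → H i * x i)) ≈⟨ +-congˡ eq ⟩
      a j * (b * y) + (y * x j * D + sum (λ i → a i * H i)) ≈⟨ x∙yz≈y∙xz _ _ _ ⟩
      y * x j * D + (a j * (b * y) + sum (λ i → a i * H i)) ≈⟨ +-cong (*-assoc _ _ _) (+-comm _ _) ⟩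
      y * (x j * D) + (sum (λ i → a i * H i) + a j * (b * y)) ≈⟨ +-congˡ (+-congˡ (sum-at-* a j (b * y))) ⟨
      y * (x j * D) + (sum (λ i → a i * H i) + sum (λ i → a i * at j (b * y) i))
        ≈⟨ +-congˡ (trans (sum-cong-≋ {n} λ i → distribˡ _ _ _) (∑-distrib-+ {n} _ _)) ⟨
      y * (x j * D) + sum (λ i → a i * (H i + at j (b * y) i)) ∎)

  -- The `a i` are a basis, as a free right module, of the right ideal that they generate.
  RightIndependent : Set (r ⊔ ℓ)
  RightIndependent = ∀ (b : Fin n → Carrier) → sum (λ i → a i * b i) ≈ 0# → ∀ i → b i ≈ 0#

  RightCancellable : Set (r ⊔ ℓ)
  RightCancellable = ∀ j b → b * a j ≈ 0# → b ≈ 0#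

-- Combinatorics of the marker words.

replicate-+ : ∀ {ℓ} {L : Set ℓ} (x : L) j k → replicate (j ℕ.+ k) x ≡ replicate j x ++ replicate k x
replicate-+ x zero    k = ≡.refl
replicate-+ x (suc j) k = ≡.cong (x ∷_) (replicate-+ x j k)

++-split : ∀ {ℓ} {L : Set ℓ} (xs {ys} us {vs} : List L) → xs ++ ys ≡ us ++ vs →
           (∃ λ e → us ≡ xs ++ e × ys ≡ e ++ vs) ⊎ (∃ λ e → xs ≡ us ++ e × vs ≡ e ++ ys)
++-split []       us       eq = inj₁ (us , ≡.refl , eq)
++-split (x ∷ xs) []       eq = inj₂ (x ∷ xs , ≡.refl , ≡.sym eq)
++-split (x ∷ xs) (u ∷ us) eq with ∷-injective eq
... | ≡.refl , eq′ with ++-split xs us eq′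
...   | inj₁ (e , p , q) = inj₁ (e , ≡.cong (x ∷_) p , q)
...   | inj₂ (e , p , q) = inj₂ (e , ≡.cong (x ∷_) p , q)

-- The words Y Xᵏ form a suffix code, and Y Xᴹ has no proper self-overlap.
module MarkerWords {ℓ : Level} {L : Set ℓ} (X Y : L) (X≢Y : X ≢ Y) where

  run : ℕ → List L
  run k = replicate k X

  marker : ℕ → List L
  marker k = Y ∷ run k

  run≢ : ∀ p v {w} → run p ≢ v ++ Y ∷ w
  run≢ zero    []      ()
  run≢ zero    (_ ∷ _) ()
  run≢ (suc p) []      eq = X≢Y (proj₁ (∷-injective eq))
  run≢ (suc p) (x ∷ v) eq = run≢ p v (proj₂ (∷-injective eq))

  run-prefix : ∀ k e {r} → run k ≡ e ++ r → ∃ λ j → j ≤ k × e ≡ run j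
  run-prefix k       []      eq = 0 , z≤n , ≡.refl
  run-prefix (suc k) (x ∷ e) eq with ∷-injective eq
  ... | ≡.refl , eq′ with run-prefix k e eq′
  ...   | j , j≤k , ≡.refl = suc j , s≤s j≤k , ≡.refl

  run-offset : ∀ k u {w r} → run k ++ w ≡ u ++ Y ∷ r → k ≤ length u
  run-offset zero    u       eq = z≤n
  run-offset (suc k) []      eq = ⊥-elim (X≢Y (proj₁ (∷-injective eq)))
  run-offset (suc k) (x ∷ u) eq = s≤s (run-offset k u (proj₂ (∷-injective eq)))

  -- The last `Y` determines both the final run and the part in front of it.
  marker-suffix : ∀ u v {p q} → u ++ marker p ≡ v ++ marker q → p ≡ q × u ≡ v
  marker-suffix []      []      {p} {q} eq =
    ≡.trans (≡.sym (length-replicate p))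
        (≡.trans (≡.cong length (proj₂ (∷-injective eq))) (length-replicate q)) , ≡.refl
  marker-suffix []      (b ∷ v) {p} eq = ⊥-elim (run≢ p v (proj₂ (∷-injective eq)))
  marker-suffix (a ∷ u) []      {q = q} eq = ⊥-elim (run≢ q u (≡.sym (proj₂ (∷-injective eq))))
  marker-suffix (a ∷ u) (b ∷ v) eq with ∷-injective eq
  ... | ≡.refl , eq′ = let (p≡q , u≡v) = marker-suffix u v eq′ in p≡q , ≡.cong (a ∷_) u≡v

  Avoids : ℕ → List L → Set ℓ
  Avoids M v = ∀ u r → v ≢ u ++ marker M ++ r

  avoids-suffix : ∀ {M} α {γ} → Avoids M (α ++ γ) → Avoids M γ
  avoids-suffix α av u r eq = av (α ++ u) r (≡.trans (≡.cong (α ++_) eq) (≡.sym (++-assoc α u _)))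

  -- An occurrence reaching beyond `v` contains the appended `Y`, so it ends in `Y Xʲ` with
  -- `j ≤ k < M`, while `marker M` ends in `Y Xᴹ`.
  avoids-++ : ∀ {M k} v → k < M → Avoids M v → Avoids M (v ++ marker k)
  avoids-++ {M} {k} v k<M av u r eq with ++-split v (u ++ marker M) (≡.trans eq (≡.sym (++-assoc u (marker M) r)))
  ... | inj₂ (e , p , _) = av u e (≡.trans p (++-assoc u (marker M) e))
  ... | inj₁ ([] , p , _) = av u [] (≡.trans (≡.sym (++-identityʳ v))
          (≡.trans (≡.sym p) (≡.cong (u ++_) (≡.sym (++-identityʳ (marker M))))))
  ... | inj₁ (x ∷ e , p , q) with ∷-injective q
  ...   | ≡.refl , q′ with run-prefix k e q′
  ...     | j , j≤k , ≡.refl = ℕ.<-irrefl (≡.sym (proj₁ (marker-suffix u v p))) (ℕ.≤-<-trans j≤k k<M)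

  module _ {n : ℕ} (B : ℕ) where

    -- Reversed, so that prepending an index appends a marker on the right, the side on which the
    -- coding equation multiplies by `x_i`. `B` will be a degree bound for the `a i`, which makes
    -- each marker longer than that bound.
    code : List (Fin n) → List L
    code []      = []
    code (i ∷ c) = code c ++ marker (B ℕ.+ toℕ i)

    length-code : ∀ c → length c ≤ length (code c)
    length-code []      = z≤n
    length-code (i ∷ c) = ℕ.≤-trans (s≤s (length-code c)) (ℕ.≤-trans (ℕ.≤-reflexive (ℕ.+-comm 1 _))
      (ℕ.≤-trans (ℕ.+-monoʳ-≤ (length (code c)) (s≤s z≤n)) (ℕ.≤-reflexive (≡.sym (length-++ (code c))))))

    module _ {M : ℕ} (B+n≤M : B ℕ.+ n ≤ M) where

      B+i<M : ∀ (i : Fin n) → B ℕ.+ toℕ i < M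
      B+i<M i = ℕ.<-≤-trans (ℕ.+-monoʳ-< B (toℕ<n i)) B+n≤M

      run-code-avoids : ∀ k c → Avoids M (run k ++ code c)
      run-code-avoids k []      u r eq = run≢ k u (≡.trans (≡.sym (++-identityʳ (run k))) eq)
      run-code-avoids k (i ∷ c) =
        ≡.subst (Avoids M) (++-assoc (run k) (code c) _)
          (avoids-++ (run k ++ code c) (B+i<M i) (run-code-avoids k c))

      -- A cut beyond `u` removes at least the `Y` of the marker. What follows is part of `Xᴹ` and
      -- of markers with runs shorter than `M`, where no further occurrence exists.
      suffix-of-coded : ∀ u c α {γ} → u ++ marker M ++ code c ≡ α ++ γ →
        (∃ λ u′ → u ≡ α ++ u′ × γ ≡ u′ ++ marker M ++ code c) ⊎ Avoids M γ
      suffix-of-coded u c α eq with ++-split u α eq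
      ... | inj₂ (e , p , q)      = inj₁ (e , p , q)
      ... | inj₁ ([] , p , q)     =
        inj₁ ([] , ≡.trans (≡.sym (≡.trans p (++-identityʳ u))) (≡.sym (++-identityʳ α)) , ≡.sym q)
      ... | inj₁ (x ∷ e , p , q) = inj₂ λ f r eq′ →
        avoids-suffix e (≡.subst (Avoids M) (proj₂ (∷-injective q)) (run-code-avoids M c)) f r eq′

      -- If `u` were not empty, it would start with the `Y` of the right-hand side, and the marker
      -- after `u` could not begin before the run `Xᴹ` is over. Counting letters would then make `w`
      -- longer than `M`.
      coded-marker-prefix : ∀ u c w → length w ≤ M → u ++ marker M ++ code c ≡ marker M ++ w →
                            u ≡ [] × w ≡ code c
      coded-marker-prefix []      c w w≤M eq = ≡.refl , ≡.sym (++-cancelˡ (marker M) _ _ eq)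
      coded-marker-prefix (x ∷ u) c w w≤M eq = ⊥-elim (ℕ.<-irrefl ≡.refl (begin-strict
        M                     ≤⟨ run-offset M u (≡.sym eq′) ⟩
        length u              <⟨ ℕ.+-cancelˡ-< M _ _ long ⟩
        length w              ≤⟨ w≤M ⟩
        M                     ∎))
        where
        open ℕ.≤-Reasoning
        eq′ = proj₂ (∷-injective eq)
        long : M ℕ.+ length u < M ℕ.+ length w
        long = begin-strict
          M ℕ.+ length u                             ≡⟨ ℕ.+-comm M (length u) ⟩
          length u ℕ.+ M                             <⟨ ℕ.+-monoʳ-< (length u) (ℕ.n<1+n M) ⟩
          length u ℕ.+ suc M                         ≡⟨ ≡.cong (λ l → length u ℕ.+ suc l) (length-replicate M) ⟨
          length u ℕ.+ length (marker M)             ≤⟨ ℕ.+-monoʳ-≤ (length u) (ℕ.m≤m+n _ _) ⟩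
          length u ℕ.+ (length (marker M) ℕ.+ length (code c)) ≡⟨ ≡.cong (length u ℕ.+_) (length-++ (marker M)) ⟨
          length u ℕ.+ length (marker M ++ code c)   ≡⟨ length-++ u ⟨
          length (u ++ marker M ++ code c)           ≡⟨ ≡.cong length eq′ ⟩
          length (run M ++ w)                        ≡⟨ length-++ (run M) ⟩
          length (run M) ℕ.+ length w                ≡⟨ ≡.cong (ℕ._+ length w) (length-replicate M) ⟩
          M ℕ.+ length w                             ∎

-- Coefficients of products, quotients by words, degree bounds.

module Coefficients {c ℓ : Level} (K : Field c ℓ) (n : ℕ) where
  open Field K hiding (zero)
  open FreeAlgebra K n renaming (_*A_ to infixl 7 _*A_; _+A_ to infixl 6 _+A_)
  open Functionals K n
  open Evaluation K n
  private
    module R = Ring ring𝔸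
    module ΣK = SemiringSum semiring
    module ΣA = SemiringSum R.semiring
  open SetoidReasoning setoid

  coeff-+ : ∀ p q w → coeff (p +A q) w ≈ coeff p w + coeff q w
  coeff-+ p q w = trans (coeff-δ (p ++ q) w) (trans (⟨⟩-++ p q) (sym (+-cong (coeff-δ p w) (coeff-δ q w))))

  coeff-sum : ∀ {m} (p : Fin m → A) w → coeff (ΣA.sum p) w ≈ ΣK.sum (λ i → coeff (p i) w)
  coeff-sum {zero}  p w = refl
  coeff-sum {suc m} p w = trans (coeff-+ (p zero) _ w) (+-congˡ (coeff-sum (p ∘ suc) w))

  prefix? : ∀ (α z : Word) → Dec (∃ λ γ → z ≡ α ++ γ)
  prefix? []      z       = yes (z , ≡.refl)
  prefix? (a ∷ α) []      = no λ ()
  prefix? (a ∷ α) (b ∷ z) with a ≟ᶠ b | prefix? α z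
  ... | yes ≡.refl | yes (γ , ≡.refl) = yes (γ , ≡.refl)
  ... | no  a≢b    | _                = no λ (γ , eq) → a≢b (≡.sym (proj₁ (∷-injective eq)))
  ... | yes ≡.refl | no  ¬pre         = no λ (γ , eq) → ¬pre (γ , proj₂ (∷-injective eq))

  suffix? : ∀ (v z : Word) → Dec (∃ λ u → z ≡ u ++ v)
  suffix? v z with ≡-dec _≟ᶠ_ z v
  suffix? v z       | yes z≡v = yes ([] , z≡v)
  suffix? v []      | no  z≢v = no λ { ([] , eq) → z≢v eq ; (_ ∷ _ , ()) }
  suffix? v (x ∷ z) | no  z≢v with suffix? v z
  ... | yes (u , ≡.refl) = yes (x ∷ u , ≡.refl)
  ... | no  ¬suf         = no λ { ([] , eq) → z≢v eq ; (_ ∷ u , eq) → ¬suf (u , proj₂ (∷-injective eq)) }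

  -- The coefficient of `q` at what remains of `z` after the prefix `α`, and zero if `α` is not a
  -- prefix. With it `coeff-*` is the convolution formula.
  tail-functional : A → Word → Word → Carrier
  tail-functional q z α = ⟨ q , (λ γ → δ z (α ++ γ)) ⟩

  coeff-* : ∀ p q z → coeff (p *A q) z ≈ ⟨ p , tail-functional q z ⟩
  coeff-* p q z = trans (coeff-δ (p *A q) z) (⟨⟩-* p q)

  tail-prefix : ∀ q α γ → tail-functional q (α ++ γ) α ≈ coeff q γ
  tail-prefix q α γ =
    trans (⟨⟩-cong q λ x → δ-inj (α ++_) {x} {γ} (++-cancelˡ α _ _)) (sym (coeff-δ q γ))

  tail-¬prefix : ∀ q α {z} → ¬ (∃ λ γ → z ≡ α ++ γ) → tail-functional q z α ≈ 0#
  tail-¬prefix q α ¬pre = trans (⟨⟩-cong q λ γ → δ-≢ λ eq → ¬pre (γ , ≡.sym eq)) (⟨⟩-0 q)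

  coeff-*-0 : ∀ p q z → (∀ α γ → z ≡ α ++ γ → coeff p α ≈ 0# ⊎ coeff q γ ≈ 0#) → coeff (p *A q) z ≈ 0#
  coeff-*-0 p q z h = trans (coeff-* p q z) (trans (⟨⟩-cong-coeff p step) (⟨⟩-0 p))
    where
    step : ∀ α → coeff p α * tail-functional q z α ≈ coeff p α * 0#
    step α with prefix? α z
    ... | no ¬pre = *-congˡ (tail-¬prefix q α ¬pre)
    ... | yes (γ , ≡.refl) with h α γ ≡.refl
    ...   | inj₁ p≈0 = trans (*-congʳ p≈0) (trans (zeroˡ _) (sym (zeroʳ _)))
    ...   | inj₂ q≈0 = *-congˡ (trans (tail-prefix q α γ) q≈0)

  coeff-word-* : ∀ v q w → coeff (word v *A q) (v ++ w) ≈ coeff q w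
  coeff-word-* v q w =
    trans (coeff-* (word v) q (v ++ w)) (trans (⟨word⟩ v (tail-functional q (v ++ w))) (tail-prefix q v w))

  coeff-word-*-0 : ∀ v q z → (∀ w → z ≡ v ++ w → coeff q w ≈ 0#) → coeff (word v *A q) z ≈ 0#
  coeff-word-*-0 v q z h = trans (coeff-* (word v) q z) (trans (⟨word⟩ v (tail-functional q z)) step)
    where
    step : tail-functional q z v ≈ 0#
    step with prefix? v z
    ... | no ¬pre          = tail-¬prefix q v ¬pre
    ... | yes (w , ≡.refl) = trans (tail-prefix q v w) (h w ≡.refl)

  private
    coeff-*-word-δ : ∀ p v z → coeff (p *A word v) z ≈ ⟨ p , (λ u → δ z (u ++ v)) ⟩
    coeff-*-word-δ p v z = trans (coeff-* p (word v) z) (⟨⟩-cong p λ u → ⟨word⟩ v (λ w → δ z (u ++ w)))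

  coeff-*-word : ∀ p v u → coeff (p *A word v) (u ++ v) ≈ coeff p u
  coeff-*-word p v u = trans (coeff-*-word-δ p v (u ++ v))
    (trans (⟨⟩-cong p λ x → δ-inj (_++ v) {x} {u} (++-cancelʳ v _ _)) (sym (coeff-δ p u)))

  coeff-*-word-0 : ∀ p v z → (∀ u → z ≢ u ++ v) → coeff (p *A word v) z ≈ 0#
  coeff-*-word-0 p v z h = trans (coeff-*-word-δ p v z)
    (trans (⟨⟩-cong p λ u → δ-≢ λ eq → h u (≡.sym eq)) (⟨⟩-0 p))

  infixl 7 _／_
  _／_ : A → Word → A
  []            ／ v = []
  ((k , w) ∷ p) ／ v with suffix? v w
  ... | yes (u , _) = (k , u) ∷ (p ／ v)
  ... | no  _       = p ／ v

  coeff-／ : ∀ p v u → coeff (p ／ v) u ≈ coeff p (u ++ v)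
  coeff-／ p v u = trans (coeff-δ (p ／ v) u) (trans (go p) (sym (coeff-δ p (u ++ v))))
    where
    go : ∀ p → ⟨ p ／ v , δ u ⟩ ≈ ⟨ p , δ (u ++ v) ⟩
    go []            = refl
    go ((k , w) ∷ p) with suffix? v w
    ... | yes (x , ≡.refl) = +-cong (*-congˡ (sym (δ-inj (_++ v) {x} {u} (++-cancelʳ v _ _)))) (go p)
    ... | no  ¬suf         = trans (go p) (sym (trans
      (+-congʳ (trans (*-congˡ (δ-≢ λ eq → ¬suf (u , eq))) (zeroʳ k))) (+-identityˡ _)))

  -- An upper bound only: the exact degree would require deciding whether a coefficient is zero.
  HasDegree≤ : ℕ → A → Set ℓ
  HasDegree≤ d p = ∀ w → d < length w → coeff p w ≈ 0#

  degree≤-mono : ∀ {d e p} → d ≤ e → HasDegree≤ d p → HasDegree≤ e p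
  degree≤-mono d≤e deg w e<w = deg w (ℕ.≤-<-trans d≤e e<w)

  degree-bound : ∀ p → ∃ λ d → HasDegree≤ d p
  degree-bound []            = 0 , λ _ _ → refl
  degree-bound ((k , u) ∷ p) with degree-bound p
  ... | d , deg = length u ℕ.⊔ d , bound
    where
    bound : ∀ w → length u ℕ.⊔ d < length w → coeff ((k , u) ∷ p) w ≈ 0#
    bound w big with ≡-dec _≟ᶠ_ u w
    ... | yes ≡.refl = ⊥-elim (ℕ.<-irrefl ≡.refl (ℕ.≤-<-trans (ℕ.m≤m⊔n (length u) d) big))
    ... | no  _      = deg w (ℕ.≤-<-trans (ℕ.m≤n⊔m (length u) d) big)

  common-degree-bound : ∀ {m} (p : Fin m → A) → ∃ λ d → ∀ i → HasDegree≤ d (p i)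
  common-degree-bound {zero}  p = 0 , λ ()
  common-degree-bound {suc m} p =
    let (d , deg) = degree-bound (p zero) ; (e , degs) = common-degree-bound (p ∘ suc) in
    d ℕ.⊔ e , λ { zero    → degree≤-mono {p = p zero} (ℕ.m≤m⊔n d e) deg
                ; (suc i) → degree≤-mono {p = p (suc i)} (ℕ.m≤n⊔m d e) (degs i) }

  word-++ : ∀ u v → word u *A word v ≃ word (u ++ v)
  word-++ u v = by-functionals λ f → trans (⟨⟩-* {f = f} (word u) (word v))
    (trans (⟨word⟩ u λ x → ⟨ word v , (λ y → f (x ++ y)) ⟩)
      (trans (⟨word⟩ v λ y → f (u ++ y)) (sym (⟨word⟩ (u ++ v) f))))

-- Decoding: from the coding equation to a polynomial in the family.

module Decoding {c ℓ : Level} (K : Field c ℓ) (m : ℕ) where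
  private
    n : ℕ
    n = suc (suc m)
  open Field K hiding (zero)
  open FreeAlgebra K n renaming (_*A_ to infixl 7 _*A_; _+A_ to infixl 6 _+A_)
  open Functionals K n
  open Evaluation K n
  open Coefficients K n
  private
    module R = Ring ring𝔸
    module ΣK = SemiringSum semiring
    module ΣA = SemiringSum R.semiring
  open SumLemmas ring
  open SemiringExp R.semiring using (_^_)
  open MarkerWords {L = Fin (suc (suc m))} zero (suc zero) (λ ())

  word-run : ∀ k → word (zero ∷ []) ^ k ≃ word (run k)
  word-run zero    = R.refl
  word-run (suc k) = R.trans (R.*-congˡ {word (zero ∷ [])} (word-run k)) (word-++ (zero ∷ []) (run k))

  module _ (a : Fin n → A) where
    open Coding ring𝔸 a

    letter-marker : ∀ B i → letter (word (zero ∷ [])) (word (marker B)) i ≃ word (marker (B ℕ.+ toℕ i))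
    letter-marker B i = R.trans (R.*-congˡ {word (marker B)} (word-run (toℕ i)))
      (R.trans (word-++ (marker B) (run (toℕ i)))
        (R.reflexive (≡.cong (λ r → word (suc zero ∷ r)) (≡.sym (replicate-+ zero B (toℕ i))))))

    module Solution (b D : A) (B d : ℕ) (a-degree : ∀ i → HasDegree≤ B (a i)) (D-degree : HasDegree≤ d D)
      (G : Fin n → A)
      (solves : CodeEq b (word (zero ∷ [])) (word (marker B)) D (word (marker (B ℕ.+ n ℕ.+ d))) G) where

      private
        -- `B + n` exceeds the run `B + i` of every `x i`, and the summand `d` makes `y` longer than
        -- the degree bound of `D`.
        M = B ℕ.+ n ℕ.+ d
        y = word (marker M)
        e = proj₁ (common-degree-bound G)
        G-degree = proj₂ (common-degree-bound G)
        x : Fin n → Word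
        x i = marker (B ℕ.+ toℕ i)

        d≤M : d ≤ M
        d≤M = ℕ.m≤n+m d (B ℕ.+ n)

        B+n≤M : B ℕ.+ n ≤ M
        B+n≤M = ℕ.m≤m+n (B ℕ.+ n) d

      coeff-solves : ∀ z → coeff (b *A y) z + ΣK.sum (λ i → coeff (G i *A word (x i)) z) ≈
                           coeff (y *A D) z + ΣK.sum (λ i → coeff (a i *A G i) z)
      coeff-solves z =
        trans (sym (trans (coeff-+ (b *A y) _ z) (+-congˡ (coeff-sum (λ i → G i *A word (x i)) z))))
          (trans (≃⇒≈A (R.trans (R.+-congˡ {b *A y}
              (ΣA.sum-cong-≋ {n} λ i → R.*-congˡ {G i} (R.sym (letter-marker B i)))) solves) z)
            (trans (coeff-+ (y *A D) _ z) (+-congˡ (coeff-sum (λ i → a i *A G i) z))))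

      by-0 : ∀ v i → coeff (b *A y) (v ++ x i) ≈ 0#
      by-0 v i = coeff-*-word-0 b (marker M) _ λ u eq →
        ℕ.<-irrefl (proj₁ (marker-suffix v u eq)) (B+i<M B B+n≤M i)

      -- By `marker-suffix` a word ending in `x i` ends in no other `x l`. Together with `by-0` this
      -- isolates the coefficient of `G i` at `v` in the equation at `v x_i`.
      Gx-sum : ∀ v i → ΣK.sum (λ l → coeff (G l *A word (x l)) (v ++ x i)) ≈ coeff (G i) v
      Gx-sum v i = trans (sum-single i λ l l≢i → coeff-*-word-0 (G l) (x l) _ λ u eq →
          l≢i (≡.sym (toℕ-injective (ℕ.+-cancelˡ-≡ B _ _ (proj₁ (marker-suffix v u eq))))))
        (coeff-*-word (G i) (x i) v)

      -- The equation at `v x_i` expresses this coefficient by coefficients of the `G l` at suffixes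
      -- of `v x_i`. These suffixes are longer than `v`, since `a l` takes at most `B` letters and
      -- `x i` has more, and they avoid the marker again. Beyond the common degree bound `e`
      -- everything is zero; `f` counts the steps that remain.
      G-avoiding : ∀ f v → e < length v ℕ.+ f → Avoids M v → ∀ i → coeff (G i) v ≈ 0#
      G-avoiding zero    v e<v av i = G-degree i v (≡.subst (e <_) (ℕ.+-identityʳ _) e<v)
      G-avoiding (suc f) v e<v av i = begin
        coeff (G i) v   ≈⟨ Gx-sum v i ⟨
        ΣK.sum (λ l → coeff (G l *A word (x l)) z) ≈⟨ +-identityˡ _ ⟨
        _ ≈⟨ +-congʳ (by-0 v i) ⟨
        _ ≈⟨ coeff-solves z ⟩
        _ ≈⟨ +-cong (coeff-word-*-0 (marker M) D z λ w eq → ⊥-elim (z-avoids [] w eq))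
                    (sum-zero λ l → coeff-*-0 (a l) (G l) z (split l)) ⟩
        0# + 0# ≈⟨ +-identityˡ 0# ⟩
        0# ∎
        where
        open SetoidReasoning setoid
        z = v ++ x i
        z-avoids : Avoids M z
        z-avoids = avoids-++ v (B+i<M B B+n≤M i) av
        split : ∀ l α γ → z ≡ α ++ γ → coeff (a l) α ≈ 0# ⊎ coeff (G l) γ ≈ 0#
        split l α γ eq with length α ℕ.≤? B
        ... | no  α≰B = inj₁ (a-degree l α (ℕ.≰⇒> α≰B))
        ... | yes α≤B = inj₂ (G-avoiding f γ (ℕ.<-≤-trans e<v (ℕ.≤-trans (ℕ.≤-reflexive (ℕ.+-suc _ f))
                (ℕ.+-monoˡ-≤ f longer))) (avoids-suffix α (≡.subst (Avoids M) eq z-avoids)) l)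
          where
          longer : suc (length v) ≤ length γ
          longer = ℕ.+-cancelˡ-≤ (length α) _ _ (ℕ.≤-Reasoning.begin
            (length α ℕ.+ suc (length v))  ℕ.≤-Reasoning.≤⟨ ℕ.+-monoˡ-≤ _ α≤B ⟩
            B ℕ.+ suc (length v)           ℕ.≤-Reasoning.≤⟨ ℕ.+-monoˡ-≤ _ (ℕ.m≤m+n B (toℕ i)) ⟩
            B ℕ.+ toℕ i ℕ.+ suc (length v) ℕ.≤-Reasoning.≡⟨ ≡.trans (ℕ.+-suc _ _) (ℕ.+-comm (suc (B ℕ.+ toℕ i)) _) ⟩
            length v ℕ.+ suc (B ℕ.+ toℕ i) ℕ.≤-Reasoning.≡⟨ ≡.cong (λ k → length v ℕ.+ suc k)
                (length-replicate (B ℕ.+ toℕ i)) ⟨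
            length v ℕ.+ length (x i)      ℕ.≤-Reasoning.≡⟨ length-++ v ⟨
            length z                       ℕ.≤-Reasoning.≡⟨ ≡.cong length eq ⟩
            length (α ++ γ)                ℕ.≤-Reasoning.≡⟨ length-++ α ⟩
            length α ℕ.+ length γ          ℕ.≤-Reasoning.∎)

      codeM : List (Fin n) → Word
      codeM c = marker M ++ code B c

      quotient : Fin n → List (Fin n) → A
      quotient i c = G i ／ codeM c

      -- A splitting whose left part goes beyond `u` leaves a word without the marker to `G l`,
      -- whose coefficient there is zero by `G-avoiding`. The remaining splittings cut inside `u`.
      aG-coeff : ∀ l c u → coeff (a l *A G l) (u ++ codeM c) ≈ coeff (a l *A quotient l c) u
      aG-coeff l c u = trans (coeff-* (a l) (G l) _)
        (trans (⟨⟩-cong (a l) step) (sym (coeff-* (a l) (quotient l c) u)))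
        where
        step : ∀ α → tail-functional (G l) (u ++ codeM c) α ≈ tail-functional (quotient l c) u α
        step α with prefix? α u
        ... | yes (u′ , ≡.refl) = trans
          (trans (reflexive (≡.cong (λ z → tail-functional (G l) z α) (++-assoc α u′ (codeM c))))
              (tail-prefix (G l) α (u′ ++ codeM c)))
          (sym (trans (tail-prefix (quotient l c) α u′) (coeff-／ (G l) (codeM c) u′)))
        ... | no ¬pre = trans left (sym (tail-¬prefix (quotient l c) α ¬pre))
          where
          left : tail-functional (G l) (u ++ codeM c) α ≈ 0#
          left with prefix? α (u ++ codeM c)
          ... | no ¬pre′ = tail-¬prefix (G l) α ¬pre′
          ... | yes (γ , eq) with suffix-of-coded B B+n≤M u c α eq
          ...   | inj₁ (u′ , u≡ , _) = ⊥-elim (¬pre (u′ , u≡))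
          ...   | inj₂ av = trans (reflexive (≡.cong (λ z → tail-functional (G l) z α) eq))
                  (trans (tail-prefix (G l) α γ) (G-avoiding (suc e) γ (ℕ.m≤n+m (suc e) _) av l))

      -- `D` is too short to contain a marker, so a leading `y` has to be the marker of `codeM c`
      -- itself, which forces `u` to be empty. Thus `y D` contributes only a scalar to each equation
      -- of the tree.
      yD-coeff : ∀ c u → coeff (y *A D) (u ++ codeM c) ≈ coeff (scalar (coeff D (code B c))) u
      yD-coeff c []      = trans (coeff-word-* (marker M) D (code B c)) (sym (+-identityʳ _))
      yD-coeff c (i ∷ u) = coeff-word-*-0 (marker M) D _ vanish
        where
        vanish : ∀ w → (i ∷ u) ++ codeM c ≡ marker M ++ w → coeff D w ≈ 0#
        vanish w eq with length w ℕ.≤? M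
        ... | no  w≰M = D-degree w (ℕ.≤-<-trans d≤M (ℕ.≰⇒> w≰M))
        ... | yes w≤M with () ← proj₁ (coded-marker-prefix B B+n≤M (i ∷ u) c w w≤M eq)

      rhs : List (Fin n) → A
      rhs c = scalar (coeff D (code B c)) +A ΣA.sum (λ l → a l *A quotient l c)

      rhs-coeff : ∀ c u → coeff (rhs c) u ≈
        coeff (y *A D) (u ++ codeM c) + ΣK.sum (λ l → coeff (a l *A G l) (u ++ codeM c))
      rhs-coeff c u = trans (coeff-+ (scalar (coeff D (code B c))) _ u)
        (+-cong (sym (yD-coeff c u)) (trans (coeff-sum (λ l → a l *A quotient l c) u)
          (ΣK.sum-cong-≋ {n} λ l → sym (aG-coeff l c u))))

      root-equation : b ≃ rhs []
      root-equation = ≈A⇒≃ λ u → begin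
        coeff b u ≈⟨ coeff-*-word b (marker M) u ⟨
        coeff (b *A y) (u ++ marker M) ≈⟨ +-identityʳ _ ⟨
        coeff (b *A y) (u ++ marker M) + 0# ≈⟨ +-congˡ (sum-zero λ l → coeff-*-word-0 (G l) (x l) _ λ v eq →
            ℕ.<-irrefl (≡.sym (proj₁ (marker-suffix u v eq))) (B+i<M B B+n≤M l)) ⟨
        _ ≈⟨ coeff-solves (u ++ marker M) ⟩
        _ ≈⟨ reflexive (≡.cong (λ z → coeff (y *A D) z + ΣK.sum (λ l → coeff (a l *A G l) z))
            (≡.cong (u ++_) (≡.sym (++-identityʳ (marker M))))) ⟩
        _ ≈⟨ rhs-coeff [] u ⟨
        coeff (rhs []) u ∎
        where open SetoidReasoning setoid

      child-equation : ∀ i c → quotient i c ≃ rhs (i ∷ c)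
      child-equation i c = ≈A⇒≃ λ u → begin
        coeff (quotient i c) u ≈⟨ coeff-／ (G i) (codeM c) u ⟩
        coeff (G i) (u ++ codeM c) ≈⟨ Gx-sum (u ++ codeM c) i ⟨
        _ ≈⟨ +-identityˡ _ ⟨
        _ ≈⟨ +-congʳ (by-0 (u ++ codeM c) i) ⟨
        _ ≈⟨ coeff-solves ((u ++ codeM c) ++ x i) ⟩
        _ ≈⟨ reflexive (≡.cong (λ z → coeff (y *A D) z + ΣK.sum (λ l → coeff (a l *A G l) z))
               (≡.trans (++-assoc u (codeM c) (x i)) (≡.cong (u ++_) (++-assoc (marker M) (code B c) (x i))))) ⟩
        _ ≈⟨ rhs-coeff (i ∷ c) u ⟨
        coeff (rhs (i ∷ c)) u ∎
        where open SetoidReasoning setoid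

      -- Descent along the tree. `code B c` has at least as many letters as `c`, so the quotients
      -- vanish once the depth exceeds `e`; `f` bounds the depth that remains.
      quotient-span : ∀ f c → e < length c ℕ.+ f → ∀ i → InSpan a (quotient i c)
      rhs-span : ∀ f c → e < length c ℕ.+ f → InSpan a (rhs c)

      rhs-span f c e<c = InSpan-+ a {scalar (coeff D (code B c))} (InSpan-scalar a _)
        (InSpan-sum a λ l → InSpan-* a (InSpan-gen a l) (quotient-span f c e<c l))

      quotient-span zero    c e<c i = InSpan-resp a {0A} (≈A⇒≃ λ u → sym (trans (coeff-／ (G i) (codeM c) u)
        (G-degree i (u ++ codeM c) (ℕ.<-≤-trans (≡.subst (e <_) (ℕ.+-identityʳ _) e<c)
          (ℕ.≤-trans (length-code B c) (ℕ.≤-trans (ℕ.m≤n+m _ (length u ℕ.+ length (marker M)))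
            (ℕ.≤-reflexive (≡.sym (≡.trans (length-++ u)
                (≡.trans (≡.cong (length u ℕ.+_) (length-++ (marker M))) (≡.sym (ℕ.+-assoc (length u) _ _))))))))))))
        (0A , R.refl)
      quotient-span (suc f) c e<c i = InSpan-resp a (R.sym (child-equation i c))
        (rhs-span f (i ∷ c) (≡.subst (e <_) (ℕ.+-suc _ f) e<c))

      span : InSpan a b
      span = InSpan-resp a (R.sym root-equation) (rhs-span (suc e) [] (ℕ.n<1+n e))

    decode : ∀ {b} → Coded b → InSpan a b
    decode {b} coded =
      let (B , a-degree) = common-degree-bound a
          (D , solve) = coded (word (zero ∷ [])) (word (marker B))
          (d , D-degree) = degree-bound D
          (G , eq) = solve (word (marker (B ℕ.+ n ℕ.+ d)))
      in Solution.span b D B d a-degree D-degree G eq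

-- Properties of free bases in every rank.

module FreeBases {c ℓ : Level} (K : Field c ℓ) (n : ℕ) where
  open Field K hiding (zero)
  open FreeAlgebra K n renaming (_*A_ to infixl 7 _*A_; _+A_ to infixl 6 _+A_)
  open Functionals K n
  open Evaluation K n
  open Coefficients K n
  private
    module R = Ring ring𝔸
    module ΣK = SemiringSum semiring
    module ΣA = SemiringSum R.semiring

  spans : ∀ {a} → MonomialsSpan a → ∀ b → InSpan a b
  spans sp b = let (p , eq) = sp b in p , ≈A⇒≃ eq

  independent : ∀ {a} → MonomialsIndependent a → ∀ p → evalAt a p ≃ 0A → p ≃ 0A
  independent ind p eq = ≈A⇒≃ (ind p (≃⇒≈A eq))

  eval-sum : ∀ a {m} (p : Fin m → A) → evalAt a (ΣA.sum p) ≃ ΣA.sum (λ i → evalAt a (p i))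
  eval-sum a {zero}  p = R.refl
  eval-sum a {suc m} p = R.trans (eval-+ a (p zero) _) (R.+-congˡ {evalAt a (p zero)} (eval-sum a (p ∘ suc)))

  infixr 7 _∖_
  _∖_ : Fin n → A → A
  i ∖ []            = []
  i ∖ ((k , w) ∷ p) with prefix? (i ∷ []) w
  ... | yes (v , _) = (k , v) ∷ (i ∖ p)
  ... | no  _       = i ∖ p

  coeff-∖ : ∀ i p v → coeff (i ∖ p) v ≈ coeff p (i ∷ v)
  coeff-∖ i p v = trans (coeff-δ (i ∖ p) v) (trans (go p) (sym (coeff-δ p (i ∷ v))))
    where
    go : ∀ p → ⟨ i ∖ p , δ v ⟩ ≈ ⟨ p , δ (i ∷ v) ⟩
    go []            = refl
    go ((k , w) ∷ p) with prefix? (i ∷ []) w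
    ... | yes (x , ≡.refl) = +-cong (*-congˡ (sym (δ-inj (i ∷_) {x} {v} (proj₂ ∘ ∷-injective)))) (go p)
    ... | no  ¬pre         = trans (go p) (sym (trans
      (+-congʳ (trans (*-congˡ (δ-≢ λ eq → ¬pre (v , eq))) (zeroʳ k))) (+-identityˡ _)))

  coeff-sum-gen : ∀ (p : Fin n → A) j w → coeff (ΣA.sum (λ i → gen i *A p i)) (j ∷ w) ≈ coeff (p j) w
  coeff-sum-gen p j w = trans (coeff-sum (λ i → gen i *A p i) (j ∷ w))
    (trans (SumLemmas.sum-single ring j λ i i≢j → coeff-word-*-0 (i ∷ []) (p i) (j ∷ w)
             λ v eq → ⊥-elim (i≢j (≡.sym (proj₁ (∷-injective eq)))))
           (coeff-word-* (j ∷ []) (p j) w))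

  first-letter : ∀ p → p ≃ scalar (coeff p []) +A ΣA.sum (λ i → gen i *A (i ∖ p))
  first-letter p = ≈A⇒≃ λ w → sym (trans (coeff-+ (scalar (coeff p [])) rest w) (go w))
    where
    rest : A
    rest = ΣA.sum (λ i → gen i *A (i ∖ p))
    go : ∀ w → coeff (scalar (coeff p [])) w + coeff rest w ≈ coeff p w
    go []      = trans (+-cong (+-identityʳ _) (trans (coeff-sum (λ i → gen i *A (i ∖ p)) [])
      (SumLemmas.sum-zero ring λ i → coeff-word-*-0 (i ∷ []) (i ∖ p) [] λ _ ()))) (+-identityʳ _)
    go (j ∷ w) = trans (+-identityˡ _) (trans (coeff-sum-gen (λ i → i ∖ p) j w) (coeff-∖ j p w))

  module _ (a : Fin n → A) where
    open Coding ring𝔸 a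

    -- Writing each `b i` as `p i` evaluated at `a` turns the relation into the vanishing of
    -- `Σ gen i * p i` at `a`. By independence this combination is zero, and the distinct first
    -- letters separate the `p i`.
    basis⇒rightIndependent : IsFreeBasis a → RightIndependent
    basis⇒rightIndependent (ind , sp) b ab≃0 i =
      R.trans (R.sym (eval-p i)) (eval-cong a {p i} {0A} (≈A⇒≃ λ w →
        trans (sym (coeff-sum-gen p i w)) (≃⇒≈A (independent ind (ΣA.sum λ i → gen i *A p i) eval≃0) (i ∷ w))))
      where
      p : Fin n → A
      p i = proj₁ (spans sp (b i))
      eval-p : ∀ i → evalAt a (p i) ≃ b i
      eval-p i = proj₂ (spans sp (b i))
      eval≃0 : evalAt a (ΣA.sum (λ i → gen i *A p i)) ≃ 0A
      eval≃0 = R.trans (eval-sum a λ i → gen i *A p i)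
        (R.trans (ΣA.sum-cong-≋ {n} λ i → R.trans (eval-* a (gen i) (p i)) (R.*-cong (eval-gen a i) (eval-p i))) ab≃0)

    basis⇒rightCancellable : IsFreeBasis a → RightCancellable
    basis⇒rightCancellable (ind , sp) j b ba≃0 =
      let (p , eval-p) = spans sp b
          p*gen≃0 = independent ind (p *A gen j)
            (R.trans (eval-* a p (gen j)) (R.trans (R.*-cong eval-p (eval-gen a j)) ba≃0))
      in R.trans (R.sym eval-p) (eval-cong a {p} {0A} (≈A⇒≃ λ w →
           trans (sym (coeff-*-word p (j ∷ []) w)) (≃⇒≈A p*gen≃0 (w ++ j ∷ []))))

    basis⇒coded : IsFreeBasis a → ∀ b → Coded b
    basis⇒coded (_ , sp) b = let (p , eq) = spans sp b in
      coded-resp eq (span-induction a Coded coded-resp coded-0 coded-1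
        (λ {b} {b′} → coded-+ {b} {b′}) (λ k {b} → coded-central (scalar k) {b} (scalar-central k))
        (λ i {b} → coded-* i {b}) p)

-- Rank at least two: criterion and defining formula.

module FreeBasesRank≥2 {c ℓ : Level} (K : Field c ℓ) (m : ℕ) where
  private
    n : ℕ
    n = suc (suc m)
  open Field K hiding (zero)
  open FreeAlgebra K n renaming (_*A_ to infixl 7 _*A_; _+A_ to infixl 6 _+A_)
  open Functionals K n
  open Evaluation K n
  open Coefficients K n
  open FreeBases K n
  private
    module R = Ring ring𝔸
    module ΣA = SemiringSum R.semiring
  open SumLemmas ring𝔸
  open SetoidReasoning R.setoid

  other : (i : Fin n) → ∃ λ j → i ≢ j
  other zero    = suc zero , λ ()
  other (suc i) = zero , λ ()

  module _ (a : Fin n → A) (rightInd : Coding.RightIndependent ring𝔸 a)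
           (rightCanc : Coding.RightCancellable ring𝔸 a) where

    -- The constant cannot be isolated directly: right multiplication by a j moves it into the
    -- j-th summand, which leaves b i * a j ≃ 0 for i ≢ j.
    summand-zero : ∀ k (b : Fin n → A) → scalar k +A ΣA.sum (λ i → a i *A b i) ≃ 0A → ∀ i → b i ≃ 0A
    summand-zero k b eq i = let (j , i≢j) = other i in
      rightCanc j (b i) (R.trans (R.sym (R.trans (R.+-congˡ {b i *A a j} (at-≢ (scalar k) i≢j)) (R.+-identityʳ _)))
        (rightInd (λ l → b l *A a j +A at j (scalar k) l) (shifted j) i))
      where
      shifted : ∀ j → ΣA.sum (λ l → a l *A (b l *A a j +A at j (scalar k) l)) ≃ 0A
      shifted j = begin
        ΣA.sum (λ l → a l *A (b l *A a j +A at j (scalar k) l))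
          ≈⟨ ΣA.sum-cong-≋ {n} (λ l → R.trans (R.distribˡ (a l) _ _)
              (R.+-congʳ {a l *A at j (scalar k) l} (R.sym (R.*-assoc (a l) (b l) (a j))))) ⟩
        ΣA.sum (λ l → (a l *A b l) *A a j +A a l *A at j (scalar k) l)
          ≈⟨ ΣA.∑-distrib-+ {n} (λ l → (a l *A b l) *A a j) (λ l → a l *A at j (scalar k) l) ⟩
        ΣA.sum (λ l → (a l *A b l) *A a j) +A ΣA.sum (λ l → a l *A at j (scalar k) l)
          ≈⟨ R.+-cong (R.sym (ΣA.*-distribʳ-sum (a j) λ l → a l *A b l))
              (R.trans (sum-at-* a j (scalar k)) (R.sym (scalar-central k (a j)))) ⟩
        ΣA.sum (λ l → a l *A b l) *A a j +A scalar k *A a j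
          ≈⟨ R.distribʳ (a j) (ΣA.sum (λ l → a l *A b l)) (scalar k) ⟨
        (ΣA.sum (λ l → a l *A b l) +A scalar k) *A a j
          ≈⟨ R.*-congʳ {a j} (R.trans (R.+-comm (ΣA.sum (λ l → a l *A b l)) (scalar k)) eq) ⟩
        0A *A a j ≈⟨ R.zeroˡ (a j) ⟩
        0A ∎

    -- Induction on `w` for all relations `p` at once. Splitting by first letters writes `p(a)` as a
    -- scalar plus `a_i` times the values of the left quotients; by `summand-zero` each left
    -- quotient is again a relation, and then the scalar is zero as well.
    coeff-zero : ∀ w p → evalAt a p ≃ 0A → coeff p w ≈ 0#
    coeff-zero w p eval≃0 = go w
      where
      eval-split : scalar (coeff p []) +A ΣA.sum (λ i → a i *A evalAt a (i ∖ p)) ≃ 0A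
      eval-split = begin
        scalar (coeff p []) +A ΣA.sum (λ i → a i *A evalAt a (i ∖ p))
          ≈⟨ R.+-cong (eval-scalar a (coeff p [])) (R.trans (eval-sum a λ i → gen i *A (i ∖ p))
               (ΣA.sum-cong-≋ {n} λ i → R.trans (eval-* a (gen i) (i ∖ p))
                   (R.*-congʳ {evalAt a (i ∖ p)} (eval-gen a i)))) ⟨
        evalAt a (scalar (coeff p [])) +A evalAt a (ΣA.sum (λ i → gen i *A (i ∖ p)))
          ≈⟨ eval-+ a (scalar (coeff p [])) (ΣA.sum (λ i → gen i *A (i ∖ p))) ⟨
        evalAt a (scalar (coeff p []) +A ΣA.sum (λ i → gen i *A (i ∖ p)))
          ≈⟨ eval-cong a (first-letter p) ⟨
        evalAt a p ≈⟨ eval≃0 ⟩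
        0A ∎
      quotients-zero : ∀ i → evalAt a (i ∖ p) ≃ 0A
      quotients-zero = summand-zero (coeff p []) (λ i → evalAt a (i ∖ p)) eval-split
      go : ∀ w → coeff p w ≈ 0#
      go []      = trans (sym (+-identityʳ _)) (≃⇒≈A constant []) 
        where
        constant : scalar (coeff p []) ≃ 0A
        constant = R.trans (R.sym (R.trans (R.+-congˡ {scalar (coeff p [])}
          (sum-zero {n} λ i → R.trans (R.*-congˡ {a i} (quotients-zero i)) (R.zeroʳ (a i))))
              (R.+-identityʳ _))) eval-split
      go (i ∷ w) = trans (sym (coeff-∖ i p w)) (coeff-zero w (i ∖ p) (quotients-zero i))

  module _ (a : Fin n → A) where
    open Coding ring𝔸 a

    isFreeBasis : RightIndependent → RightCancellable → (∀ b → Coded b) → IsFreeBasis a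
    isFreeBasis ri rc coded = (λ p eval≈0 w → coeff-zero a ri rc w p (≈A⇒≃ eval≈0)) ,
      λ b → let (p , eq) = Decoding.decode K m a {b} (coded b) in p , ≃⇒≈A eq

  open Syntax
  open SemanticsLemmas K n
  open Semantics (𝔸 K n)

  independentF cancellableF codedF genF : Formula n
  independentF = ∀* n ((sumT n (λ i → var (n ↑ʳ i) ⊗ var (i ↑ˡ n)) ≐ 𝟘) ⇒f ⋀ n (λ i → var (i ↑ˡ n) ≐ 𝟘))
  cancellableF = ⋀ n λ j → ∀f (((var zero ⊗ var (suc j)) ≐ 𝟘) ⇒f (var zero ≐ 𝟘))

  -- The outer variables of the equation are, innermost first: y, D, t, s, b and then a.
  equationF : Formula (n ℕ.+ suc (suc (suc (suc (suc n)))))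
  equationF =
    ((b ⊗ y) ⊕ sumT n (λ i → var (i ↑ˡ _) ⊗ (t ⊗ powT s (toℕ i)))) ≐
    ((y ⊗ D) ⊕ sumT n (λ i → var (n ↑ʳ suc (suc (suc (suc (suc i))))) ⊗ var (i ↑ˡ _)))
    where
    y = var (n ↑ʳ zero)
    D = var (n ↑ʳ suc zero)
    t = var (n ↑ʳ suc (suc zero))
    s = var (n ↑ʳ suc (suc (suc zero)))
    b = var (n ↑ʳ suc (suc (suc (suc zero))))

  codedF = ∀f (∀f (∀f (∃f (∀f (∃* n equationF)))))
  genF = independentF ∧f (cancellableF ∧f codedF)

  module _ (a : Fin n → A) where
    open Coding ring𝔸 a

    ⊨independentF : (⊨ independentF [ a ]) ⇔ RightIndependent
    ⊨independentF = mk⇔ to from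
      where
      body = (sumT n (λ i → var (n ↑ʳ i) ⊗ var (i ↑ˡ n)) ≐ 𝟘) ⇒f ⋀ n (λ i → var (i ↑ˡ n) ≐ 𝟘)
      value : ∀ v → ⟦ sumT n (λ i → var (n ↑ʳ i) ⊗ var (i ↑ˡ n)) ⟧t (extends v a) ≡ ΣA.sum (λ i → a i *A lookup v i)
      value v = ≡.trans (⟦sumT⟧ n (λ i → var (n ↑ʳ i) ⊗ var (i ↑ˡ n)) (extends v a))
        (ΣA.sum-cong-≗ {n} λ i → ≡.cong₂ _*A_ (extends-↑ʳ v a i) (extends-↑ˡ v a i))
      to : ⊨ independentF [ a ] → RightIndependent
      to h b ab≃0 i = ≈A⇒≃ (≡.subst (_≈A 0A) (≡.trans (extends-↑ˡ v a i) (lookup∘tabulate b i))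
        (lower (Equivalence.to (⊨⋀ n (λ i → var (i ↑ˡ n) ≐ 𝟘) (extends v a))
          (Equivalence.to (⊨∀* n body a) h v (lift (≃⇒≈A (R.trans (R.reflexive (value v))
            (R.trans (ΣA.sum-cong-≋ {n} λ i → R.*-congˡ {a i} (R.reflexive (lookup∘tabulate b i))) ab≃0))))) i)))
        where v = Vec.tabulate b
      from : RightIndependent → ⊨ independentF [ a ]
      from ri = Equivalence.from (⊨∀* n body a) λ v hyp →
        Equivalence.from (⊨⋀ n (λ i → var (i ↑ˡ n) ≐ 𝟘) (extends v a)) λ i →
          lift (≡.subst (_≈A 0A) (≡.sym (extends-↑ˡ v a i))
            (≃⇒≈A (ri (lookup v) (R.trans (R.sym (R.reflexive (value v))) (≈A⇒≃ (lower hyp))) i)))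

    ⊨cancellableF : (⊨ cancellableF [ a ]) ⇔ RightCancellable
    ⊨cancellableF = mk⇔
      (λ h j b ba≃0 → ≈A⇒≃ (lower (Equivalence.to (⊨⋀ n body a) h j b (lift (≃⇒≈A ba≃0)))))
      (λ rc → Equivalence.from (⊨⋀ n body a) λ j b hyp → lift (≃⇒≈A (rc j b (≈A⇒≃ (lower hyp)))))
      where
      body : Fin n → Formula n
      body j = ∀f (((var zero ⊗ var (suc j)) ≐ 𝟘) ⇒f (var zero ≐ 𝟘))

    ⊨codedF : (⊨ codedF [ a ]) ⇔ (∀ b → Coded b)
    ⊨codedF = mk⇔ to from
      where
      env : (b s t D y : A) → Fin (suc (suc (suc (suc (suc n))))) → A
      env b s t D y = extend y (extend D (extend t (extend s (extend b a))))
      module _ (b s t D y : A) (v : Vec A n) where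
        ρ = extends v (env b s t D y)
        old : ∀ j → ρ (n ↑ʳ j) ≡ env b s t D y j
        old = extends-↑ʳ v (env b s t D y)
        new : ∀ i → ρ (i ↑ˡ _) ≡ lookup v i
        new = extends-↑ˡ v (env b s t D y)
        lettersT aGT : Fin n → Term (n ℕ.+ suc (suc (suc (suc (suc n)))))
        lettersT i = var (i ↑ˡ _) ⊗ (var (n ↑ʳ suc (suc zero)) ⊗ powT (var (n ↑ʳ suc (suc (suc zero)))) (toℕ i))
        aGT i = var (n ↑ʳ suc (suc (suc (suc (suc i))))) ⊗ var (i ↑ˡ _)
        left : ρ (n ↑ʳ suc (suc (suc (suc zero)))) *A ρ (n ↑ʳ zero) +A ⟦ sumT n lettersT ⟧t ρ ≡
               b *A y +A ΣA.sum (λ i → lookup v i *A letter s t i)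
        left = ≡.cong₂ _+A_ (≡.cong₂ _*A_ (old (suc (suc (suc (suc zero))))) (old zero)) (≡.trans (⟦sumT⟧ n lettersT ρ)
          (ΣA.sum-cong-≗ {n} λ i → ≡.cong₂ _*A_ (new i) (≡.cong₂ _*A_ (old (suc (suc zero)))
            (≡.trans (⟦powT⟧ (toℕ i) (var (n ↑ʳ suc (suc (suc zero)))) ρ)
              (≡.cong (λ x → SemiringExp._^_ R.semiring x (toℕ i)) (old (suc (suc (suc zero)))))))))
        right : ρ (n ↑ʳ zero) *A ρ (n ↑ʳ suc zero) +A ⟦ sumT n aGT ⟧t ρ ≡
                y *A D +A ΣA.sum (λ i → a i *A lookup v i)
        right = ≡.cong₂ _+A_ (≡.cong₂ _*A_ (old zero) (old (suc zero))) (≡.trans (⟦sumT⟧ n aGT ρ)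
          (ΣA.sum-cong-≗ {n} λ i → ≡.cong₂ _*A_ (old (suc (suc (suc (suc (suc i)))))) (new i)))
      to : ⊨ codedF [ a ] → ∀ b → Coded b
      to h b s t = let (D , h′) = h b s t in D , λ y →
        let (v , eq) = Equivalence.to (⊨∃* n equationF (env b s t D y)) (h′ y) in
        lookup v , R.trans (R.sym (R.reflexive (left b s t D y v)))
          (R.trans (≈A⇒≃ (lower eq)) (R.reflexive (right b s t D y v)))
      from : (∀ b → Coded b) → ⊨ codedF [ a ]
      from coded b s t = let (D , solve) = coded b s t in D , λ y →
        let (G , eq) = solve y ; v = Vec.tabulate G in
        Equivalence.from (⊨∃* n equationF (env b s t D y)) (v , lift (≃⇒≈A (
          R.trans (R.reflexive (left b s t D y v))
          (R.trans (R.+-congˡ {b *A y} (ΣA.sum-cong-≋ {n} λ i → R.*-congʳ {letter s t i}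
              (R.reflexive (lookup∘tabulate G i))))
          (R.trans eq
          (R.trans (R.+-congˡ {y *A D} (ΣA.sum-cong-≋ {n} λ i → R.*-congˡ {a i}
              (R.reflexive (≡.sym (lookup∘tabulate G i)))))
          (R.sym (R.reflexive (right b s t D y v)))))))))

    ⊨genF : (⊨ genF [ a ]) ⇔ IsFreeBasis a
    ⊨genF = mk⇔
      (λ (h₁ , h₂ , h₃) → isFreeBasis a (Equivalence.to ⊨independentF h₁)
        (Equivalence.to ⊨cancellableF h₂) (Equivalence.to ⊨codedF h₃))
      (λ basis → Equivalence.from ⊨independentF (basis⇒rightIndependent a basis) ,
        Equivalence.from ⊨cancellableF (basis⇒rightCancellable a basis) ,
        Equivalence.from ⊨codedF (basis⇒coded a basis))

-- Nilpotents and units in a commutative ring.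

module Nilpotents {r ℓ : Level} (R : CommutativeRing r ℓ) where
  open CommutativeRing R hiding (zero)
  open CommutativeSemiringExp commutativeSemiring using (_^_; ^-distrib-*; ^-congˡ)
  open CommutativeSemigroupProperties *-commutativeSemigroup using (x∙yz≈y∙xz)
  open RingProperties ring using (-‿distribʳ-*; -1*x≈-x)
  open SetoidReasoning setoid

  Unit Nilpotent : Carrier → Set (r ⊔ ℓ)
  Unit x      = ∃ λ y → x * y ≈ 1#
  Nilpotent x = Lift (r ⊔ ℓ) (∃ λ e → x ^ e ≈ 0#)

  nilpotent-resp : ∀ {x y} → x ≈ y → Nilpotent x → Nilpotent y
  nilpotent-resp x≈y (lift (e , x^e≈0)) = lift (e , trans (^-congˡ e (sym x≈y)) x^e≈0)

  nilpotent-0 : Nilpotent 0#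
  nilpotent-0 = lift (1 , zeroˡ _)

  nilpotent-* : ∀ x {y} → Nilpotent y → Nilpotent (x * y)
  nilpotent-* x {y} (lift (e , y^e≈0)) = lift (e , trans (^-distrib-* x y e) (trans (*-congˡ y^e≈0) (zeroʳ _)))

  nilpotent-neg : ∀ {x} → Nilpotent x → Nilpotent (- x)
  nilpotent-neg {x} nx = nilpotent-resp (-1*x≈-x x) (nilpotent-* (- 1#) nx)

  private
    -- The factor `z` replaces the binomial theorem: one factor `x + y` is multiplied into `z`, and
    -- the exponent of `x` drops for `x z`, that of `y` for `y z`.
    annihilate-+ : ∀ d e {x y} z → x ^ d * z ≈ 0# → y ^ e * z ≈ 0# → (x + y) ^ (d ℕ.+ e) * z ≈ 0#
    annihilate-+ zero    e       z x₀ y₀ = trans (*-congˡ (trans (sym (*-identityˡ z)) x₀)) (zeroʳ _)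
    annihilate-+ (suc d) zero    z x₀ y₀ = trans (*-congˡ (trans (sym (*-identityˡ z)) y₀)) (zeroʳ _)
    annihilate-+ (suc d) (suc e) {x} {y} z x₀ y₀ = begin
      (x + y) * (x + y) ^ (d ℕ.+ suc e) * z          ≈⟨ trans (*-assoc _ _ _) (x∙yz≈y∙xz _ _ _) ⟩
      (x + y) ^ (d ℕ.+ suc e) * ((x + y) * z)        ≈⟨ *-congˡ (distribʳ z x y) ⟩
      (x + y) ^ (d ℕ.+ suc e) * (x * z + y * z)      ≈⟨ distribˡ _ _ _ ⟩
      (x + y) ^ (d ℕ.+ suc e) * (x * z) + (x + y) ^ (d ℕ.+ suc e) * (y * z)
        ≈⟨ +-cong (annihilate-+ d (suc e) (x * z) (absorb x d x₀) (pull x (suc e) y₀))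
                  (trans (*-congʳ (reflexive (≡.cong ((x + y) ^_) (ℕ.+-suc d e))))
                    (annihilate-+ (suc d) e (y * z) (pull y (suc d) x₀) (absorb y e y₀))) ⟩
      0# + 0#                                        ≈⟨ +-identityˡ 0# ⟩
      0#                                             ∎
      where
      absorb : ∀ w k → w ^ suc k * z ≈ 0# → w ^ k * (w * z) ≈ 0#
      absorb w k eq = trans (x∙yz≈y∙xz _ _ _) (trans (sym (*-assoc _ _ _)) eq)
      pull : ∀ {w} v k → w ^ k * z ≈ 0# → w ^ k * (v * z) ≈ 0#
      pull v k eq = trans (x∙yz≈y∙xz _ _ _) (trans (*-congˡ eq) (zeroʳ v))

  nilpotent-+ : ∀ {x y} → Nilpotent x → Nilpotent y → Nilpotent (x + y)
  nilpotent-+ (lift (d , x₀)) (lift (e , y₀)) = lift (d ℕ.+ e , trans (sym (*-identityʳ _))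
    (annihilate-+ d e 1# (trans (*-identityʳ _) x₀) (trans (*-identityʳ _) y₀)))

  unit-+-nilpotent : ∀ {g s} → Unit g → Nilpotent s → Unit (g + s)
  unit-+-nilpotent {g} {s} (h , gh≈1) (lift (e , s^e≈0)) = solve e 1# (trans (*-identityʳ _) s^e≈0)
    where
    -- The geometric series for `1 / (g + s)` in Horner form: if `(g + s) q = s z`, then `h (z - q)`
    -- is a solution for `z`, and `s z` is killed by a smaller power of `s`.
    solve : ∀ e z → s ^ e * z ≈ 0# → ∃ λ q → (g + s) * q ≈ z
    solve zero    z s₀ = 0# , trans (zeroʳ _) (trans (sym s₀) (*-identityˡ z))
    solve (suc e) z s₀ =
      let (q , eq) = solve e (s * z) (trans (x∙yz≈y∙xz _ _ _) (trans (sym (*-assoc _ _ _)) s₀)) in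
      h * (z - q) , (begin
        (g + s) * (h * (z - q))                        ≈⟨ x∙yz≈y∙xz _ _ _ ⟩
        h * ((g + s) * (z - q))                        ≈⟨ *-congˡ (distribˡ _ _ _) ⟩
        h * ((g + s) * z + (g + s) * - q)
          ≈⟨ *-congˡ (+-cong (distribʳ z g s) (trans (sym (-‿distribʳ-* _ _)) (-‿cong eq))) ⟩
        h * (g * z + s * z - s * z)
          ≈⟨ *-congˡ (trans (+-assoc _ _ _) (trans (+-congˡ (-‿inverseʳ _)) (+-identityʳ _))) ⟩
        h * (g * z)
          ≈⟨ trans (sym (*-assoc _ _ _)) (*-congʳ (trans (*-comm h g) gh≈1)) ⟩
        1# * z                                         ≈⟨ *-identityˡ z ⟩
        z                                              ∎)

-- Rank one: commutative polynomials and their values.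

module Univariate {c ℓ : Level} (K : Field c ℓ) (infinite : Infinite K) where
  open Field K hiding (zero)
  open FreeAlgebra K 1 renaming (_*A_ to infixl 7 _*A_; _+A_ to infixl 6 _+A_)
  open Functionals K 1
  open Evaluation K 1
  open Coefficients K 1
  open FreeBases K 1
  open CommutativeSemiringExp commutativeSemiring using (_^_; ^-homo-*; ^-congˡ)
  open RingProperties ring using (-‿distribˡ-*; x∙y⁻¹≈ε⇒x≈y)
  open CommutativeSemigroupProperties *-commutativeSemigroup using (x∙yz≈y∙xz)
  private
    module R = Ring ring𝔸
    module ΣA = SemiringSum R.semiring
  open SetoidReasoning setoid

  X : A
  X = gen zero

  power : ℕ → Word
  power k = replicate k zero

  words-by-length : ∀ (u v : Word) → length u ≡ length v → u ≡ v
  words-by-length []         []         eq = ≡.refl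
  words-by-length (zero ∷ u) (zero ∷ v) eq = ≡.cong (zero ∷_) (words-by-length u v (ℕ.suc-injective eq))

  *A-comm : ∀ p q → p *A q ≃ q *A p
  *A-comm p q = by-functionals λ f → trans (⟨⟩-* p q) (trans (⟨⟩-swap _ p q)
    (trans (⟨⟩-cong q λ v → ⟨⟩-cong p λ u → reflexive (≡.cong f (words-by-length (u ++ v) (v ++ u)
      (≡.trans (length-++ u) (≡.trans (ℕ.+-comm (length u) _) (≡.sym (length-++ v))))))) (sym (⟨⟩-* q p))))

  commutativeRing𝔸 : CommutativeRing c (c ⊔ ℓ)
  commutativeRing𝔸 = record { isCommutativeRing = record { isRing = R.isRing ; *-comm = *A-comm } }

  module NilK = Nilpotents commutativeRing
  module NilA = Nilpotents commutativeRing𝔸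
  private
    module C = CommutativeRing commutativeRing𝔸
    open CommutativeSemigroupProperties C.*-commutativeSemigroup using () renaming (x∙yz≈y∙xz to *A-leftComm)
    open CommutativeSemigroupProperties C.+-commutativeSemigroup using () renaming (interchange to +A-interchange)

  at-point : Carrier → A → Carrier
  at-point κ p = ⟨ p , (λ w → κ ^ length w) ⟩

  at-cong : ∀ κ {p q} → p ≃ q → at-point κ p ≈ at-point κ q
  at-cong κ p≃q = functional p≃q _

  at-+ : ∀ κ p q → at-point κ (p +A q) ≈ at-point κ p + at-point κ q
  at-+ κ p q = ⟨⟩-++ p q

  at-* : ∀ κ p q → at-point κ (p *A q) ≈ at-point κ p * at-point κ q
  at-* κ p q = trans (⟨⟩-* p q) (trans (⟨⟩-cong p λ u →
      trans (⟨⟩-cong q λ v → trans (reflexive (≡.cong (κ ^_) (length-++ u))) (^-homo-* κ (length u) (length v)))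
            (⟨⟩-*ˡ q (κ ^ length u)))
    (⟨⟩-*ʳ p (at-point κ q)))

  at-scalar : ∀ κ k → at-point κ (scalar k) ≈ k
  at-scalar κ k = trans (⟨scalar⟩ k λ w → κ ^ length w) (*-identityʳ k)

  at-X : ∀ κ → at-point κ X ≈ κ
  at-X κ = trans (⟨word⟩ (zero ∷ []) λ w → κ ^ length w) (*-identityʳ κ)

  at-^ : ∀ κ p e → at-point κ (CommutativeSemiringExp._^_ C.commutativeSemiring p e) ≈ at-point κ p ^ e
  at-^ κ p zero    = at-scalar κ 1#
  at-^ κ p (suc e) = trans (at-* κ p _) (*-congˡ (at-^ κ p e))

  at-nilpotent : ∀ κ {p} → NilA.Nilpotent p → NilK.Nilpotent (at-point κ p)
  at-nilpotent κ {p} (lift (e , eq)) = lift (e , trans (sym (at-^ κ p e)) (at-cong κ eq))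

  at-eval : ∀ κ a p → at-point κ (evalAt a p) ≈ at-point (at-point κ (a zero)) p
  at-eval κ a p = trans (⟨⟩-eval a p) (⟨⟩-cong p at-monomial)
    where
    at-monomial : ∀ w → at-point κ (monomial a w) ≈ at-point κ (a zero) ^ length w
    at-monomial []         = at-scalar κ 1#
    at-monomial (zero ∷ w) = trans (at-* κ (a zero) _) (*-congˡ (at-monomial w))

  -- Constants up to nilpotents, and units.

  -- A class that can be defined by a formula where the constants themselves are out of reach: it is
  -- a subring containing the scalars, and its elements are exactly the sums of two units.
  NearConstant : A → Set (c ⊔ ℓ)
  NearConstant q = ∃ λ k → ∃ λ j → NilA.Nilpotent j × q ≃ scalar k +A j

  near-resp : ∀ {p q} → p ≃ q → NearConstant p → NearConstant q
  near-resp p≃q (k , j , nj , eq) = k , j , nj , R.trans (R.sym p≃q) eq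

  scalar-+ : ∀ k l → scalar (k + l) ≃ scalar k +A scalar l
  scalar-+ k l = by-functionals λ f → trans (⟨scalar⟩ (k + l) f) (trans (distribʳ _ k l)
    (sym (trans (⟨⟩-++ {f = f} (scalar k) (scalar l)) (+-cong (⟨scalar⟩ k f) (⟨scalar⟩ l f)))))

  near-scalar : ∀ k → NearConstant (scalar k)
  near-scalar k = k , 0A , NilA.nilpotent-0 , R.refl

  near-+ : ∀ {p q} → NearConstant p → NearConstant q → NearConstant (p +A q)
  near-+ (k , j , nj , eq) (k′ , j′ , nj′ , eq′) = k + k′ , j +A j′ , NilA.nilpotent-+ nj nj′ ,
    R.trans (R.+-cong eq eq′) (R.trans (+A-interchange (scalar k) j (scalar k′) j′)
        (R.+-congʳ {j +A j′} (R.sym (scalar-+ k k′))))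

  near-* : ∀ {p q} → NearConstant p → NearConstant q → NearConstant (p *A q)
  near-* {p} {q} (k , j , nj , eq) (k′ , j′ , nj′ , eq′) =
    k * k′ , scalar k *A j′ +A q *A j , NilA.nilpotent-+ (NilA.nilpotent-* (scalar k) nj′) (NilA.nilpotent-* q nj) ,
    R.trans (R.*-congʳ {q} eq) (R.trans (R.distribʳ q (scalar k) j)
      (R.trans (R.+-cong (R.trans (R.*-congˡ {scalar k} eq′) (R.distribˡ (scalar k) (scalar k′) j′)) (*A-comm j q))
        (R.+-assoc (scalar k *A scalar k′) (scalar k *A j′) (q *A j))))

  monomial-coeff : ∀ k v w → coeff ((k , v) ∷ []) w ≈ k * δ w v
  monomial-coeff k v w = trans (coeff-δ ((k , v) ∷ []) w) (+-identityʳ _)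

  scalar-coeff : ∀ k p w → coeff (scalar k *A p) w ≈ k * coeff p w
  scalar-coeff k p w = trans (coeff-δ (scalar k *A p) w) (trans (functional (scalar-* k p) (δ w))
    (trans (⟨⟩-· k p) (*-congˡ (sym (coeff-δ p w)))))

  -- In a splitting of the word of length `d + m`, a left part longer than `d` is killed by the
  -- bound for `z`, and a shorter one by the bound for `u`.
  top-coeff : ∀ {d m z u} → HasDegree≤ d z → HasDegree≤ m u →
              coeff (z *A u) (power (d ℕ.+ m)) ≈ coeff z (power d) * coeff u (power m)
  top-coeff {d} {m} {z} {u} deg-z deg-u = begin
    coeff (z *A u) (power (d ℕ.+ m))                       ≈⟨ coeff-* z u _ ⟩
    ⟨ z , tail-functional u (power (d ℕ.+ m)) ⟩            ≈⟨ ⟨⟩-cong-coeff z step ⟩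
    ⟨ z , (λ α → δ (power d) α * coeff u (power m)) ⟩      ≈⟨ ⟨⟩-*ʳ z (coeff u (power m)) ⟩
    ⟨ z , δ (power d) ⟩ * coeff u (power m)                ≈⟨ *-congʳ (coeff-δ z (power d)) ⟨
    coeff z (power d) * coeff u (power m)                  ∎
    where
    step : ∀ α → coeff z α * tail-functional u (power (d ℕ.+ m)) α ≈ coeff z α * (δ (power d) α * coeff u (power m))
    step α with ℕ.<-cmp (length α) d
    ... | tri> _ _ d<α = trans (trans (*-congʳ (deg-z α d<α)) (zeroˡ _)) (sym (trans (*-congʳ (deg-z α d<α)) (zeroˡ _)))
    ... | tri≈ _ eq _ with words-by-length α (power d) (≡.trans eq (≡.sym (length-replicate d)))
    ...   | ≡.refl = *-congˡ (trans (trans (reflexive (≡.cong (λ w → tail-functional u w α) (replicate-+ zero d m)))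
                       (tail-prefix u α (power m)))
                       (sym (trans (*-congʳ (δ-refl {α} ≡.refl)) (*-identityˡ _))))
    step α | tri< α<d _ _ = *-congˡ (trans vanish (sym (trans (*-congʳ (δ-≢ {α} {power d} λ eq →
               ℕ.<-irrefl (≡.trans (≡.cong length eq) (length-replicate d {x = zero})) α<d)) (zeroˡ _))))
      where
      vanish : tail-functional u (power (d ℕ.+ m)) α ≈ 0#
      vanish with prefix? α (power (d ℕ.+ m))
      ... | no ¬pre        = tail-¬prefix u α ¬pre
      ... | yes (γ , eq) = trans (reflexive (≡.cong (λ w → tail-functional u w α) eq)) (trans (tail-prefix u α γ)
              (deg-u γ (ℕ.+-cancelˡ-< (length α) _ _ (ℕ.<-≤-trans (ℕ.+-monoˡ-< m α<d)
                (ℕ.≤-reflexive (≡.trans (≡.sym (length-replicate (d ℕ.+ m)))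
                    (≡.trans (≡.cong length eq) (length-++ α))))))))

  private
    open SemiringExp R.semiring using () renaming (_^_ to _^A_)

    below-top : ∀ {d p} → HasDegree≤ (suc d) p → coeff p (power (suc d)) ≈ 0# → HasDegree≤ d p
    below-top {d} {p} deg top w d<w with ℕ.m≤n⇒m<n∨m≡n d<w
    ... | inj₁ big = deg w big
    ... | inj₂ eq  = trans (reflexive (≡.cong (coeff p) (words-by-length w (power (suc d))
                       (≡.trans (≡.sym eq) (≡.sym (length-replicate (suc d))))))) top

    degree-0 : ∀ {p} → HasDegree≤ 0 p → p ≃ scalar (coeff p [])
    degree-0 {p} deg = ≈A⇒≃ λ { [] → sym (+-identityʳ _) ; (i ∷ w) → deg (i ∷ w) (s≤s z≤n) }

    scalar-degree : ∀ {d} k p → HasDegree≤ d p → HasDegree≤ d (scalar k *A p)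
    scalar-degree k p deg w d<w = trans (scalar-coeff k p w) (trans (*-congˡ (deg w d<w)) (zeroʳ k))

    -- If z u is constant and u has top coefficient α, then multiplying z by α lowers its degree.
    annihilate : ∀ m u → HasDegree≤ (suc m) u → ∀ d z k → HasDegree≤ d z → z *A u ≃ scalar k →
                 scalar (coeff u (power (suc m))) ^A suc d *A z ≃ 0A
    annihilate m u deg-u d z k deg-z zu≃k =
      R.trans (R.*-congʳ {z} (*A-comm (scalar α) (scalar α ^A d)))
        (R.trans (R.*-assoc (scalar α ^A d) (scalar α) z) (lower-degree d deg-z top-zero))
      where
      α = coeff u (power (suc m))
      αz : A
      αz = scalar α *A z
      top-zero : coeff αz (power d) ≈ 0#
      top-zero = begin
        coeff αz (power d)                      ≈⟨ scalar-coeff α z (power d) ⟩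
        α * coeff z (power d)                   ≈⟨ *-comm _ _ ⟩
        coeff z (power d) * α                   ≈⟨ top-coeff {z = z} {u} deg-z deg-u ⟨
        coeff (z *A u) (power (d ℕ.+ suc m))    ≈⟨ ≃⇒≈A zu≃k _ ⟩
        coeff (scalar k) (power (d ℕ.+ suc m))  ≡⟨ ≡.cong (λ e → coeff (scalar k) (power e)) (ℕ.+-suc d m) ⟩
        0#                                      ∎
      lower-degree : ∀ d → HasDegree≤ d z → coeff αz (power d) ≈ 0# → scalar α ^A d *A αz ≃ 0A
      lower-degree zero    deg top = R.trans (R.*-identityˡ αz)
        (R.trans (degree-0 {αz} (scalar-degree α z deg)) (R.trans (scalar-cong top) scalar-0))
      lower-degree (suc d) deg top = annihilate m u deg-u d αz (α * k)
        (below-top {d} {αz} (scalar-degree α z deg) top)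
        (R.trans (R.*-assoc (scalar α) z u) (R.*-congˡ {scalar α} zu≃k))

  -- The classical argument for units of a polynomial ring. For the inverse `v`, `annihilate` makes
  -- a power of the top coefficient `α` kill `v`; multiplying by `u` shows that this power is zero.
  -- Removing the nilpotent top term `t` leaves a unit with a smaller degree bound.
  unit⇒near : ∀ m u → HasDegree≤ m u → NilA.Unit u → NearConstant u
  unit⇒near zero    u deg _ = coeff u [] , 0A , NilA.nilpotent-0 ,
    R.trans (degree-0 {u} deg) (R.sym (R.+-identityʳ _))
  unit⇒near (suc m) u deg (v , uv≃1) =
    near-resp restore (near-+ (unit⇒near m u′ deg′ unit′)
        (0# , t , nil-t , R.sym (R.trans (R.+-congʳ {t} scalar-0) (R.+-identityˡ t))))
    where
    α = coeff u (power (suc m))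
    d = proj₁ (degree-bound v)
    nil-α : NilA.Nilpotent (scalar α)
    nil-α = lift (suc d , R.trans (R.sym (R.*-identityʳ _))
      (R.trans (R.*-congˡ {scalar α ^A suc d} (R.sym vu≃1))
        (R.trans (R.sym (R.*-assoc (scalar α ^A suc d) v u))
          (R.*-congʳ {u} (annihilate m u deg d v 1# (proj₂ (degree-bound v)) vu≃1)))))
      where
      vu≃1 : v *A u ≃ 1A
      vu≃1 = R.trans (*A-comm v u) uv≃1
    t : A
    t = scalar α *A word (power (suc m))
    nil-t : NilA.Nilpotent t
    nil-t = NilA.nilpotent-resp (*A-comm (word (power (suc m))) (scalar α))
        (NilA.nilpotent-* (word (power (suc m))) nil-α)
    u′ : A
    u′ = u +A (-A t)
    restore : u′ +A t ≃ u
    restore = R.trans (R.+-assoc u (-A t) t) (R.trans (R.+-congˡ {u} (R.-‿inverseˡ t)) (R.+-identityʳ u))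
    unit′ : NilA.Unit u′
    unit′ = NilA.unit-+-nilpotent {u} { -A t} (v , uv≃1) (NilA.nilpotent-neg nil-t)
    coeff-u′ : ∀ w → coeff u′ w ≈ coeff u w - α * δ w (power (suc m))
    coeff-u′ w = trans (coeff-+ u (-A t) w) (+-congˡ (trans (monomial-coeff (- 1# * (α * 1#)) (power (suc m)) w)
      (trans (*-congʳ (trans (sym (-‿distribˡ-* _ _)) (-‿cong (trans (*-identityˡ _) (*-identityʳ α)))))
          (sym (-‿distribˡ-* _ _)))))
    deg′ : HasDegree≤ m u′
    deg′ = below-top {m} {u′}
      (λ w big → trans (coeff-u′ w) (trans (+-cong (deg w big) (-‿cong (trans (*-congˡ (δ-≢ {power (suc m)} {w} λ eq →
          ℕ.<-irrefl (≡.trans (≡.sym (length-replicate (suc m))) (≡.cong length eq)) big)) (zeroʳ α))))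
              (-‿inverseʳ 0#)))
      (trans (coeff-u′ (power (suc m)))
          (trans (+-congˡ (-‿cong (trans (*-congˡ (δ-refl {power (suc m)} ≡.refl)) (*-identityʳ α)))) (-‿inverseʳ α)))

  units⇒near : ∀ {u} → NilA.Unit u → NearConstant u
  units⇒near {u} = let (m , deg) = degree-bound u in unit⇒near m u deg

  scalar-unit : ∀ k → ¬ k ≈ 0# → NilA.Unit (scalar k)
  scalar-unit k k≉0 = let (k⁻¹ , eq) = inverse k k≉0 in scalar k⁻¹ , scalar-cong eq

  cancel-minus : ∀ x y → x + (y - x) ≈ y
  cancel-minus x y = trans (+-comm _ _) (trans (+-assoc _ _ _) (trans (+-congˡ (-‿inverseˡ x)) (+-identityʳ y)))

  -- With `y` different from `0` and from `k`, both `y` and `k - y` are invertible, and the second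
  -- stays so after adding the nilpotent part. This works for `k = 0` too.
  near⇒units : ∀ {q} → NearConstant q → ∃ λ u → ∃ λ v → NilA.Unit u × NilA.Unit v × u +A v ≃ q
  near⇒units (k , j , nj , eq) with infinite (0# ∷ k ∷ [])
  ... | y , (y≉0 ∷ y≉k ∷ []) = scalar y , scalar (k - y) +A j , scalar-unit y y≉0 ,
    NilA.unit-+-nilpotent {scalar (k - y)} {j} (scalar-unit (k - y) λ k-y≈0 → y≉k (sym (x∙y⁻¹≈ε⇒x≈y k y k-y≈0))) nj ,
    R.trans (R.sym (R.+-assoc (scalar y) (scalar (k - y)) j))
      (R.trans (R.+-congʳ {j} (R.trans (R.sym (scalar-+ y (k - y))) (scalar-cong (cancel-minus y k)))) (R.sym eq))

  -- Polynomials whose values lie in an ideal at infinitely many points.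

  shift : A → A
  shift p = zero ∖ p

  shift-split : ∀ p → p ≃ scalar (coeff p []) +A X *A shift p
  shift-split p = R.trans (first-letter p) (R.+-congˡ {scalar (coeff p [])} (R.+-identityʳ (X *A shift p)))

  shift-degree : ∀ {d} p → HasDegree≤ (suc d) p → HasDegree≤ d (shift p)
  shift-degree p deg w d<w = trans (coeff-∖ zero p w) (deg (zero ∷ w) (s≤s d<w))

  at-split : ∀ κ k p → at-point κ (scalar k +A X *A p) ≈ k + κ * at-point κ p
  at-split κ k p = trans (at-+ κ (scalar k) (X *A p)) (+-cong (at-scalar κ k) (trans (at-* κ X p) (*-congʳ (at-X κ))))

  at-shift : ∀ κ p → at-point κ p ≈ coeff p [] + κ * at-point κ (shift p)
  at-shift κ p = trans (at-cong κ (shift-split p)) (at-split κ (coeff p []) (shift p))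

  at-degree-0 : ∀ κ p → HasDegree≤ 0 p → at-point κ p ≈ coeff p []
  at-degree-0 κ p deg = trans (at-cong κ (degree-0 {p} deg)) (at-scalar κ _)

  -- (p - p(κ₀)) / (x - κ₀), by Horner's scheme.
  quotient : Carrier → ℕ → A → A
  quotient κ₀ zero    p = 0A
  quotient κ₀ (suc d) p = scalar (at-point κ₀ (shift p)) +A X *A quotient κ₀ d (shift p)

  coeff-quotient-[] : ∀ k q → coeff (scalar k +A X *A q) [] ≈ k
  coeff-quotient-[] k q = trans (coeff-+ (scalar k) (X *A q) [])
    (trans (+-cong (+-identityʳ k) (coeff-word-*-0 (zero ∷ []) q [] λ _ ())) (+-identityʳ k))

  coeff-quotient-∷ : ∀ k q w → coeff (scalar k +A X *A q) (zero ∷ w) ≈ coeff q w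
  coeff-quotient-∷ k q w = trans (coeff-+ (scalar k) (X *A q) (zero ∷ w))
    (trans (+-identityˡ _) (coeff-word-* (zero ∷ []) q w))

  quotient-degree : ∀ κ₀ d p → HasDegree≤ d (quotient κ₀ (suc d) p)
  quotient-degree κ₀ zero    p (zero ∷ w) d<w       = coeff-quotient-∷ (at-point κ₀ (shift p)) 0A w
  quotient-degree κ₀ (suc d) p (zero ∷ w) (s≤s d<w) =
    trans (coeff-quotient-∷ (at-point κ₀ (shift p)) (quotient κ₀ (suc d) (shift p)) w)
        (quotient-degree κ₀ d (shift p) w d<w)

  quotient-eq : ∀ κ₀ κ d p → HasDegree≤ d p →
                at-point κ p ≈ at-point κ₀ p + (κ - κ₀) * at-point κ (quotient κ₀ d p)
  quotient-eq κ₀ κ zero    p deg = trans (at-degree-0 κ p deg) (trans (sym (at-degree-0 κ₀ p deg))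
    (sym (trans (+-congˡ (zeroʳ _)) (+-identityʳ _))))
  quotient-eq κ₀ κ (suc d) p deg = begin
    at-point κ p                                ≈⟨ at-shift κ p ⟩
    k + κ * at-point κ p₁                       ≈⟨ +-congˡ (*-congˡ (quotient-eq κ₀ κ d p₁ (shift-degree p deg))) ⟩
    k + κ * (e + (κ - κ₀) * q)
      ≈⟨ +-congˡ (trans (distribˡ κ _ _) (+-cong (*-congʳ κ-split) (x∙yz≈y∙xz κ _ q))) ⟩
    k + ((κ₀ + (κ - κ₀)) * e + (κ - κ₀) * (κ * q))
      ≈⟨ +-congˡ (trans (+-congʳ (distribʳ e κ₀ _)) (trans (+-assoc _ _ _) (+-congˡ (sym (distribˡ _ e _))))) ⟩
    k + (κ₀ * e + (κ - κ₀) * (e + κ * q))       ≈⟨ +-assoc _ _ _ ⟨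
    k + κ₀ * e + (κ - κ₀) * (e + κ * q)         ≈⟨ +-cong (at-shift κ₀ p) (*-congˡ (at-split κ e (quotient κ₀ d p₁))) ⟨
    at-point κ₀ p + (κ - κ₀) * at-point κ (quotient κ₀ (suc d) p) ∎
    where
    p₁ = shift p
    k  = coeff p []
    e  = at-point κ₀ p₁
    q  = at-point κ (quotient κ₀ d p₁)
    κ-split : κ ≈ κ₀ + (κ - κ₀)
    κ-split = sym (cancel-minus κ₀ κ)

  -- `I` is an ideal of `K` and `T` an infinite set of points. Two cases occur: the nilradical with
  -- all points, and the zero ideal with the values of a polynomial.
  module Roots {s t : Level} (I : Carrier → Set s) (I-resp : ∀ {x y} → x ≈ y → I x → I y)
    (I-0 : I 0#) (I-+ : ∀ {x y} → I x → I y → I (x + y)) (I-* : ∀ x {y} → I y → I (x * y))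
    (T : Carrier → Set t) (T-infinite : ∀ xs → ∃ λ κ → T κ × All (λ x → ¬ κ ≈ x) xs) where

    private
      I-minus : ∀ {x y} → I (x + y) → I y → I x
      I-minus {x} {y} Ixy Iy = I-resp
        (trans (+-congˡ (trans (sym (-‿distribˡ-* _ _)) (-‿cong (*-identityˡ y))))
          (trans (+-assoc _ _ _) (trans (+-congˡ (-‿inverseʳ y)) (+-identityʳ x))))
        (I-+ Ixy (I-* (- 1#) Iy))

      -- The constant coefficient of the quotient is the value of `shift p` at `κ₀`. With `p(κ₀)` it
      -- yields the constant coefficient of `p`, and the other coefficients are those of `shift p`,
      -- whose quotient is the rest of the Horner scheme.
      from-quotient : ∀ κ₀ d p → HasDegree≤ d p → I (at-point κ₀ p) →
                      (∀ w → I (coeff (quotient κ₀ d p) w)) → ∀ w → I (coeff p w)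
      from-quotient κ₀ zero    p deg Ip IQ []         = I-resp (at-degree-0 κ₀ p deg) Ip
      from-quotient κ₀ zero    p deg Ip IQ (zero ∷ w) = I-resp (sym (deg (zero ∷ w) (s≤s z≤n))) I-0
      from-quotient κ₀ (suc d) p deg Ip IQ = λ
        { []         → I-minus (I-resp (at-shift κ₀ p) Ip) (I-* κ₀ Ip₁)
        ; (zero ∷ w) → I-resp (coeff-∖ zero p w) (from-quotient κ₀ d (shift p) (shift-degree p deg) Ip₁
            (λ v → I-resp (coeff-quotient-∷ (at-point κ₀ (shift p)) (quotient κ₀ d (shift p)) v) (IQ (zero ∷ v))) w) }
        where
        Ip₁ : I (at-point κ₀ (shift p))
        Ip₁ = I-resp (coeff-quotient-[] (at-point κ₀ (shift p)) (quotient κ₀ d (shift p))) (IQ [])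

    -- Induction on the degree bound, dividing by `x - κ₀`. Values of the quotient are controlled
    -- only where `κ - κ₀` is invertible, so `xs` records the points already used.
    coeffs-from-values : ∀ d p → HasDegree≤ d p → ∀ xs →
      (∀ κ → T κ → All (λ x → ¬ κ ≈ x) xs → I (at-point κ p)) → ∀ w → I (coeff p w)
    coeffs-from-values zero    p deg xs values []         = let (κ , Tκ , κ#) = T-infinite xs in
      I-resp (at-degree-0 κ p deg) (values κ Tκ κ#)
    coeffs-from-values zero    p deg xs values (zero ∷ w) = I-resp (sym (deg (zero ∷ w) (s≤s z≤n))) I-0
    coeffs-from-values (suc d) p deg xs values =
      from-quotient κ₀ (suc d) p deg (values κ₀ Tκ₀ κ₀#)
        (coeffs-from-values d Q (quotient-degree κ₀ d p) (κ₀ ∷ xs) quotient-values)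
      where
      κ₀ = proj₁ (T-infinite xs)
      Tκ₀ = proj₁ (proj₂ (T-infinite xs))
      κ₀# = proj₂ (proj₂ (T-infinite xs))
      Q = quotient κ₀ (suc d) p
      quotient-values : ∀ κ → T κ → All (λ x → ¬ κ ≈ x) (κ₀ ∷ xs) → I (at-point κ Q)
      quotient-values κ Tκ (κ≉κ₀ ∷ κ#) =
        I-resp (trans (sym (*-assoc _ _ _)) (trans (*-congʳ (trans (*-comm _ _) inv)) (*-identityˡ _)))
          (I-* u (I-minus (I-resp (trans (quotient-eq κ₀ κ (suc d) p deg) (+-comm _ _)) (values κ Tκ κ#))
              (values κ₀ Tκ₀ κ₀#)))
        where
        u = proj₁ (inverse (κ - κ₀) λ eq → κ≉κ₀ (x∙y⁻¹≈ε⇒x≈y κ κ₀ eq))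
        inv = proj₂ (inverse (κ - κ₀) λ eq → κ≉κ₀ (x∙y⁻¹≈ε⇒x≈y κ κ₀ eq))

    vanishing-coeffs : ∀ p → (∀ κ → T κ → I (at-point κ p)) → ∀ w → I (coeff p w)
    vanishing-coeffs p values = let (d , deg) = degree-bound p in
      coeffs-from-values d p deg [] λ κ Tκ _ → values κ Tκ

  -- Removing nilpotents: Nakayama's lemma.

  module _ (a : Fin 1 → A) where

    -- The ideal generated by the list; the index lets `nakayama` discard the generators one at a
    -- time.
    data Combination : List A → A → Set (c ⊔ ℓ) where
      nil  : ∀ {j} → j ≃ 0A → Combination [] j
      cons : ∀ {r rs j} s {j′} → Combination rs j′ → j ≃ r *A s +A j′ → Combination (r ∷ rs) j

    comb-resp : ∀ {rs i j} → i ≃ j → Combination rs i → Combination rs j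
    comb-resp i≃j (nil eq)      = nil (R.trans (R.sym i≃j) eq)
    comb-resp i≃j (cons s c eq) = cons s c (R.trans (R.sym i≃j) eq)

    comb-0 : ∀ rs → Combination rs 0A
    comb-0 []       = nil R.refl
    comb-0 (r ∷ rs) = cons 0A (comb-0 rs) (R.sym (R.trans (R.+-identityʳ _) (R.zeroʳ r)))

    comb-+ : ∀ {rs i j} → Combination rs i → Combination rs j → Combination rs (i +A j)
    comb-+ (nil eq) (nil eq′) = nil (R.trans (R.+-cong eq eq′) (R.+-identityʳ 0A))
    comb-+ {r ∷ rs} (cons s {i′} c eq) (cons s′ {j′} c′ eq′) = cons (s +A s′) (comb-+ c c′)
      (R.trans (R.+-cong eq eq′) (R.trans (+A-interchange (r *A s) i′ (r *A s′) j′)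
        (R.+-congʳ {i′ +A j′} (R.sym (R.distribˡ r s s′)))))

    comb-* : ∀ {rs j} z → Combination rs j → Combination rs (z *A j)
    comb-* z (nil eq)            = nil (R.trans (R.*-congˡ {z} eq) (R.zeroʳ z))
    comb-* {r ∷ rs} z (cons s {j′} c eq) = cons (z *A s) (comb-* z c)
      (R.trans (R.*-congˡ {z} eq) (R.trans (R.distribˡ z (r *A s) j′)
        (R.+-congʳ {z *A j′} (*A-leftComm z r s))))

    SpanModulo : List A → A → Set (c ⊔ ℓ)
    SpanModulo rs q = ∃ λ β → ∃ λ j → InSpan a β × Combination rs j × q ≃ β +A j

    -- Nakayama's lemma for the subalgebra generated by a and finitely many nilpotents in it.
    nakayama : ∀ rs → All (λ r → InSpan a r × NilA.Nilpotent r) rs →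
               (∀ q → SpanModulo rs q) → ∀ q → InSpan a q
    nakayama []       []                                 dec q with dec q
    ... | β , j , Bβ , nil j≃0 , eq = InSpan-resp a
        (R.sym (R.trans eq (R.trans (R.+-congˡ {β} j≃0) (R.+-identityʳ β)))) Bβ
    nakayama (r ∷ rs) ((Br , lift (e , r^e≃0)) ∷ hyps) dec = nakayama rs hyps λ q →
      let (β , s , j , Bβ , cj , eq) = iterate e q in
      β , j , Bβ , cj , R.trans eq (R.+-congˡ {β}
          (R.trans (R.+-congʳ {j} (R.trans (R.*-congʳ {s} r^e≃0) (R.zeroˡ s))) (R.+-identityˡ j)))
      where
      InSpan-^ : ∀ e → InSpan a (r ^A e)
      InSpan-^ zero    = InSpan-scalar a 1#
      InSpan-^ (suc e) = InSpan-* a Br (InSpan-^ e)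
      -- Decomposing the cofactor `s` of `r^e` in turn raises the power of `r`, which finally
      -- vanishes; what is left over lies in the ideal of the other generators.
      iterate : ∀ e q → ∃ λ β → ∃ λ s → ∃ λ j → InSpan a β × Combination rs j × q ≃ β +A (r ^A e *A s +A j)
      iterate zero    q = 0A , q , 0A , (0A , R.refl) , comb-0 rs ,
        R.sym (R.trans (R.+-identityˡ _) (R.trans (R.+-identityʳ _) (R.*-identityˡ q)))
      iterate (suc e) q with iterate e q
      ... | β , s , j , Bβ , cj , eq with dec s
      ...   | β′ , _ , Bβ′ , cons s′ {j′} cj′ eq₂ , eq₁ =
        β +A r^e *A β′ , s′ , r^e *A j′ +A j , InSpan-+ a Bβ (InSpan-* a (InSpan-^ e) Bβ′) , comb-+
            (comb-* r^e cj′) cj ,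
        R.trans eq (R.trans (R.+-congˡ {β} (R.trans (R.+-congʳ {j} expand)
          (R.trans (R.+-assoc (r^e *A β′) _ j) (R.+-congˡ {r^e *A β′} (R.+-assoc (r ^A suc e *A s′) (r^e *A j′) j)))))
          (R.sym (R.+-assoc β (r^e *A β′) _)))
        where
        r^e = r ^A e
        expand : r^e *A s ≃ r^e *A β′ +A (r ^A suc e *A s′ +A r^e *A j′)
        expand = R.trans (R.*-congˡ {r^e} (R.trans eq₁ (R.+-congˡ {β′} eq₂)))
          (R.trans (R.distribˡ r^e β′ _) (R.+-congˡ {r^e *A β′} (R.trans (R.distribˡ r^e (r *A s′) j′)
            (R.+-congʳ {r^e *A j′} (R.trans (R.sym (R.*-assoc r^e r s′)) (R.*-congʳ {s′} (*A-comm r^e r)))))))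

    collect-combination : ∀ W p → Combination (map (λ w → scalar (coeff p w)) W) (collect W p)
    collect-combination []      p = nil R.refl
    collect-combination (w ∷ W) p = cons (word w) (collect-combination W p)
      (R.+-congʳ {collect W p} (by-functionals λ f → +-congʳ (*-congʳ (sym (*-identityʳ (coeff p w))))))

    -- Modulo the ideal, `X` is congruent to an element of the subalgebra, hence so is every
    -- polynomial in `X`.
    spanModulo-all : ∀ rs {β j} → InSpan a β → Combination rs j → X ≃ β +A j → ∀ q → SpanModulo rs q
    spanModulo-all rs {β₀} {j₀} Bβ₀ cj₀ X≃ q = resp (eval-gens q)
      (span-induction gen (SpanModulo rs) resp zeroS oneS plusS scalarS genS q)
      where
      resp : ∀ {p q} → p ≃ q → SpanModulo rs p → SpanModulo rs q
      resp p≃q (β , j , Bβ , cj , eq) = β , j , Bβ , cj , R.trans (R.sym p≃q) eq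
      zeroS : SpanModulo rs 0A
      zeroS = 0A , 0A , (0A , R.refl) , comb-0 rs , R.refl
      oneS : SpanModulo rs 1A
      oneS = 1A , 0A , InSpan-scalar a 1# , comb-0 rs , R.sym (R.+-identityʳ 1A)
      plusS : ∀ {p q} → SpanModulo rs p → SpanModulo rs q → SpanModulo rs (p +A q)
      plusS (β , j , Bβ , cj , eq) (β′ , j′ , Bβ′ , cj′ , eq′) = β +A β′ , j +A j′ , InSpan-+ a Bβ Bβ′ , comb-+ cj cj′ ,
        R.trans (R.+-cong eq eq′) (+A-interchange β j β′ j′)
      scalarS : ∀ k {q} → SpanModulo rs q → SpanModulo rs (scalar k *A q)
      scalarS k (β , j , Bβ , cj , eq) = scalar k *A β , scalar k *A j , InSpan-* a
          (InSpan-scalar a k) Bβ , comb-* (scalar k) cj ,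
        R.trans (R.*-congˡ {scalar k} eq) (R.distribˡ (scalar k) β j)
      genS : ∀ i {q} → SpanModulo rs q → SpanModulo rs (gen i *A q)
      genS zero {q} (β , j , Bβ , cj , eq) = β₀ *A β , β *A j₀ +A X *A j , InSpan-* a Bβ₀ Bβ , comb-+
          (comb-* β cj₀) (comb-* X cj) ,
        R.trans (R.*-congˡ {X} eq) (R.trans (R.distribˡ X β j) (R.trans
          (R.+-congʳ {X *A j} (R.trans (R.*-congʳ {β} X≃)
              (R.trans (R.distribʳ β β₀ j₀) (R.+-congˡ {β₀ *A β} (*A-comm j₀ β)))))
          (R.+-assoc (β₀ *A β) (β *A j₀) (X *A j))))
      eval-gens : ∀ q → evalAt gen q ≃ q
      eval-gens q = by-functionals λ f → trans (⟨⟩-eval gen q)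
          (⟨⟩-cong q λ w → trans (functional (monomial-gens w) f) (⟨word⟩ w f))
        where
        monomial-gens : ∀ w → monomial gen w ≃ word w
        monomial-gens []      = R.refl
        monomial-gens (i ∷ w) = R.trans (R.*-congˡ {gen i} (monomial-gens w)) (word-++ (i ∷ []) w)

    -- The ideal is generated by the coefficients of `X - D(a)`. Being scalars they lie in the
    -- subalgebra, as `nakayama` requires of its generators.
    spans-modulo-nilpotents : ∀ D → (∀ w → NilK.Nilpotent (coeff (X +A (-A evalAt a D)) w)) → ∀ q → InSpan a q
    spans-modulo-nilpotents D nil-coeffs = nakayama rs (hyps W)
      (spanModulo-all rs {evalAt a D} {f} (D , R.refl) (comb-resp (R.sym (normal≃ f)) (collect-combination W f))
        (R.sym (R.trans (R.+-comm (evalAt a D) f)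
            (R.trans (R.+-assoc X (-A evalAt a D) (evalAt a D))
                (R.trans (R.+-congˡ {X} (R.-‿inverseˡ (evalAt a D))) (R.+-identityʳ X))))))
      where
      f = X +A (-A evalAt a D)
      W = support f
      rs = map (λ w → scalar (coeff f w)) W
      scalar-^ : ∀ k e → scalar k ^A e ≃ scalar (k ^ e)
      scalar-^ k zero    = R.refl
      scalar-^ k (suc e) = R.*-congˡ {scalar k} (scalar-^ k e)
      hyps : ∀ W → All (λ r → InSpan a r × NilA.Nilpotent r) (map (λ w → scalar (coeff f w)) W)
      hyps []      = []
      hyps (w ∷ W) = (InSpan-scalar a _ , nil-scalar (nil-coeffs w)) ∷ hyps W
        where
        nil-scalar : ∀ {k} → NilK.Nilpotent k → NilA.Nilpotent (scalar k)
        nil-scalar {k} (lift (e , eq)) = lift (e , R.trans (scalar-^ k e) (R.trans (scalar-cong eq) scalar-0))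

  -- Interpolation characterises free bases of rank one.

  module _ (a : Fin 1 → A) where
    private
      α = a zero

    InterpolationAt : A → A → A → A → A → A → A → A → A → A → Set (c ⊔ ℓ)
    InterpolationAt x D u v c c′ d d′ G H = c *A c′ ≃ 1A × d *A d′ ≃ 1A ×
      x +A (u +A v) *A G ≃ c +A d +A α *A G × D +A (u +A v) *A H ≃ c +A d +A x *A H

    -- There is a D such that for every constant λ some constant c satisfies x ≡ c mod (α - λ) and
    -- D ≡ c mod (x - λ).  The constants λ = u + v and c are given as sums of two units.
    Interpolated : A → Set (c ⊔ ℓ)
    Interpolated x = ∃ λ D → ∀ u u′ v v′ → u *A u′ ≃ 1A → v *A v′ ≃ 1A →
      ∃ λ c → ∃ λ c′ → ∃ λ d → ∃ λ d′ → ∃ λ G → ∃ λ H → InterpolationAt x D u v c c′ d d′ G H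

    private
      near-eval : ∀ {z} → NearConstant z → ∀ p → NearConstant (evalAt (λ _ → z) p)
      near-eval {z} near-z = span-induction (λ _ → z) NearConstant near-resp
        (near-resp scalar-0 (near-scalar 0#)) (near-scalar 1#) (λ {p} {q} → near-+ {p} {q})
        (λ k {q} → near-* {scalar k} {q} (near-scalar k)) (λ _ {q} → near-* {z} {q} near-z)


      -- Divisibility of `p(y) - p(z)` by `y - z`, without subtraction. The witness for a monomial
      -- comes from `y m - z m′ = (y - z) m + z (m - m′)`.
      divided-difference : ∀ (y z : Fin 1 → A) p → ∃ λ G → evalAt y p +A z zero *A G ≃ evalAt z p +A y zero *A G
      divided-difference y z []            = 0A , R.trans (R.zeroʳ (z zero)) (R.sym (R.zeroʳ (y zero)))
      divided-difference y z ((k , w) ∷ p) =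
        let (G , eq) = monomial-difference w ; (H , eq′) = divided-difference y z p in
        scalar k *A G +A H ,
        R.trans (split y z G H) (R.trans (R.+-cong (scaled G eq) eq′) (R.sym (split z y G H)))
        where
        y₀ = y zero
        z₀ = z zero
        monomial-difference : ∀ w → ∃ λ G → monomial y w +A z₀ *A G ≃ monomial z w +A y₀ *A G
        monomial-difference []         = 0A , R.+-congˡ {1A} (R.trans (R.zeroʳ z₀) (R.sym (R.zeroʳ y₀)))
        monomial-difference (zero ∷ w) = let (G , eq) = monomial-difference w ; m = monomial y w ; m′ = monomial z w in
          m +A z₀ *A G ,
          R.trans (R.+-congˡ {y₀ *A m} (R.trans (R.*-congˡ {z₀} eq) (R.distribˡ z₀ m′ (y₀ *A G))))
            (R.trans (R.sym (R.+-assoc (y₀ *A m) (z₀ *A m′) _))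
                (R.trans (R.+-congʳ {z₀ *A (y₀ *A G)} (R.+-comm (y₀ *A m) (z₀ *A m′)))
              (R.trans (R.+-assoc (z₀ *A m′) (y₀ *A m) _) (R.+-congˡ {z₀ *A m′} (R.trans
                (R.+-congˡ {y₀ *A m} (*A-leftComm z₀ y₀ G)) (R.sym (R.distribˡ y₀ m (z₀ *A G))))))))
        scaled : ∀ G → monomial y w +A z₀ *A G ≃ monomial z w +A y₀ *A G →
                 scalar k *A monomial y w +A scalar k *A (z₀ *A G) ≃ scalar k *A monomial z w +A scalar k *A (y₀ *A G)
        scaled G eq = R.trans (R.sym (R.distribˡ (scalar k) (monomial y w) (z₀ *A G)))
          (R.trans (R.*-congˡ {scalar k} eq) (R.distribˡ (scalar k) (monomial z w) (y₀ *A G)))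
        split : ∀ (y z : Fin 1 → A) G H → (k ·A monomial y w +A evalAt y p) +A z zero *A (scalar k *A G +A H) ≃
                (scalar k *A monomial y w +A scalar k *A (z zero *A G)) +A (evalAt y p +A z zero *A H)
        split y z G H = R.trans (R.+-cong (R.+-congʳ {evalAt y p} (R.sym (scalar-* k (monomial y w))))
          (R.trans (R.distribˡ (z zero) (scalar k *A G) H)
              (R.+-congʳ {z zero *A H} (*A-leftComm (z zero) (scalar k) G))))
          (+A-interchange (scalar k *A monomial y w) (evalAt y p) (scalar k *A (z zero *A G)) (z zero *A H))

    -- If `x = p(a)`, then `D` is `p(x)` and the constant for `λ` is `p(λ)`; both congruences are
    -- divided differences of `p`.
    basis⇒interpolated : IsFreeBasis a → ∀ x → Interpolated x
    basis⇒interpolated (_ , sp) x =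
      let (p , eval-p) = spans sp x in
      evalAt (λ _ → x) p , λ u u′ v v′ uu′ vv′ →
      let l = u +A v
          (c , d , (c′ , cc′) , (d′ , dd′) , c+d) = near⇒units
              (near-eval {l} (near-+ {u} {v} (units⇒near (u′ , uu′)) (units⇒near (v′ , vv′))) p)
          (G , eq) = divided-difference a (λ _ → l) p
          (H , eq′) = divided-difference (λ _ → x) (λ _ → l) p
      in c , c′ , d , d′ , G , H , cc′ , dd′ ,
         R.trans (R.+-congʳ {l *A G} (R.sym eval-p)) (R.trans eq (R.+-congʳ {α *A G} (R.sym c+d))) ,
         R.trans eq′ (R.+-congʳ {x *A H} (R.sym c+d))

    private
      open RingProperties ring using (-1*x≈-x; +-cancelʳ; -‿+-comm)
      open CommutativeSemigroupProperties +-commutativeSemigroup using (interchange)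

      cancel-common : ∀ k x y → (k + x) - (k + y) ≈ x - y
      cancel-common k x y = trans (+-congˡ (sym (-‿+-comm k y))) (trans (interchange k x (- k) (- y))
        (trans (+-congʳ (-‿inverseʳ k)) (+-identityˡ _)))

    -- With `λ = a(κ)` the first congruence is read at `κ` and the second at `a(κ)`, where `α - λ`
    -- and `x - λ` vanish respectively. This gives `κ` and `D(a(κ))` as values of one near constant,
    -- and its values differ only by nilpotents.
    interpolated⇒nilpotent : ((D , _) : Interpolated X) → ∀ κ → NilK.Nilpotent (at-point κ (X +A (-A evalAt a D)))
    interpolated⇒nilpotent (D , interpolate) κ with infinite (0# ∷ at-point κ α ∷ [])
    -- The choice of `y` splits `l` into the two units `y` and `l - y`.
    ... | y , (y≉0 ∷ y≉l ∷ []) =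
      let u = scalar y ; v = scalar (l - y)
          (u′ , uu′) = scalar-unit y y≉0
          (v′ , vv′) = scalar-unit (l - y) λ eq → y≉l (sym (x∙y⁻¹≈ε⇒x≈y l y eq))
          (c , c′ , d , d′ , G , H , cc′ , dd′ , eq₁ , eq₂) = interpolate u u′ v v′ uu′ vv′
          (k , j , nj , c+d) = near-+ {c} {d} (units⇒near (c′ , cc′)) (units⇒near (d′ , dd′))
          at-c+d : ∀ μ → at-point μ (c +A d) ≈ k + at-point μ j
          at-c+d μ = trans (at-cong μ c+d) (trans (at-+ μ (scalar k) j) (+-congʳ (at-scalar μ k)))
          κ≈ : κ ≈ k + at-point κ j
          κ≈ = trans (sym (at-X κ)) (trans (cancel κ X α G (c +A d) refl eq₁) (at-c+d κ))
          D≈ : at-point l D ≈ k + at-point l j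
          D≈ = trans (cancel l D X H (c +A d) (at-X l) eq₂) (at-c+d l)
      in NilK.nilpotent-resp (sym (begin
           at-point κ (X +A (-A evalAt a D))            ≈⟨ at-+ κ X (-A evalAt a D) ⟩
           at-point κ X + at-point κ (-A evalAt a D)
             ≈⟨ +-cong (trans (at-X κ) κ≈) (trans (⟨⟩-· (- 1#) (evalAt a D)) (trans (-1*x≈-x _)
                                                             (-‿cong (trans (at-eval κ a D) D≈)))) ⟩
           (k + at-point κ j) - (k + at-point l j)      ≈⟨ cancel-common k _ _ ⟩
           at-point κ j - at-point l j                  ∎))
         (NilK.nilpotent-+ (at-nilpotent κ nj) (NilK.nilpotent-neg (at-nilpotent l nj)))
      where
      l = at-point κ α
      at-l : ∀ μ → at-point μ (scalar y +A scalar (l - y)) ≈ l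
      at-l μ = trans (at-+ μ (scalar y) (scalar (l - y))) 
        (trans (+-cong (at-scalar μ y) (at-scalar μ (l - y))) (cancel-minus y l))
      cancel : ∀ μ p q G r → at-point μ q ≈ l →
               p +A (scalar y +A scalar (l - y)) *A G ≃ r +A q *A G → at-point μ p ≈ at-point μ r
      cancel μ p q G r at-q eq = +-cancelʳ (l * at-point μ G) _ _ (begin
        at-point μ p + l * at-point μ G
          ≈⟨ +-congˡ (trans (at-* μ (scalar y +A scalar (l - y)) G) (*-congʳ (at-l μ))) ⟨
        at-point μ p + at-point μ ((scalar y +A scalar (l - y)) *A G) ≈⟨ at-+ μ p ((scalar y +A scalar (l - y)) *A G) ⟨
        at-point μ (p +A (scalar y +A scalar (l - y)) *A G)        ≈⟨ at-cong μ eq ⟩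
        at-point μ (r +A q *A G)                                   ≈⟨ at-+ μ r (q *A G) ⟩
        at-point μ r + at-point μ (q *A G)                         ≈⟨ +-congˡ (trans (at-* μ q G) (*-congʳ at-q)) ⟩
        at-point μ r + l * at-point μ G                            ∎)

    -- If `p(a) = 0`, then `p` vanishes at all values `a(μ)`, and these are infinitely many because
    -- `D` recovers `μ` from `a(μ)`.
    span⇒independent : InSpan a X → MonomialsIndependent a
    span⇒independent (D , eval-D) p eval≈0 = Roots.vanishing-coeffs (_≈ 0#) (λ x≈y → trans (sym x≈y)) refl
      (λ x≈0 y≈0 → trans (+-cong x≈0 y≈0) (+-identityˡ 0#)) (λ x y≈0 → trans (*-congˡ y≈0) (zeroʳ x))
      (λ κ → ∃ λ μ → at-point μ α ≈ κ) values-infinite p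
      λ κ (μ , at-μ) → trans (⟨⟩-cong p λ w → ^-congˡ (length w) (sym at-μ))
          (trans (sym (at-eval μ a p)) (at-cong μ {evalAt a p} {0A} (≈A⇒≃ eval≈0)))
      where
      D-inverts : ∀ μ → at-point (at-point μ α) D ≈ μ
      D-inverts μ = trans (sym (at-eval μ a D)) (trans (at-cong μ eval-D) (at-X μ))
      apart : ∀ μ xs → All (λ x → ¬ μ ≈ x) (map (λ x → at-point x D) xs) → All (λ x → ¬ at-point μ α ≈ x) xs
      apart μ []       []       = []
      apart μ (x ∷ xs) (px ∷ pxs) =
        (λ eq → px (trans (sym (D-inverts μ)) (⟨⟩-cong D λ w → ^-congˡ (length w) eq))) ∷ apart μ xs pxs
      values-infinite : ∀ xs → ∃ λ κ → (∃ λ μ → at-point μ α ≈ κ) × All (λ x → ¬ κ ≈ x) xs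
      values-infinite xs = let (μ , μ#) = infinite (map (λ x → at-point x D) xs) in
        at-point μ α , (μ , refl) , apart μ xs μ#

    interpolated⇒basis : Interpolated X → IsFreeBasis a
    interpolated⇒basis int = span⇒independent (span X) , λ b → let (p , eq) = span b in p , ≃⇒≈A eq
      where
      span : ∀ q → InSpan a q
      span = spans-modulo-nilpotents a (proj₁ int) (Roots.vanishing-coeffs NilK.Nilpotent NilK.nilpotent-resp
        NilK.nilpotent-0 NilK.nilpotent-+ NilK.nilpotent-* (λ _ → ⊤)
        (λ xs → let (κ , κ#) = infinite xs in κ , tt , κ#)
            (X +A (-A evalAt a (proj₁ int))) λ κ _ → interpolated⇒nilpotent int κ)

  -- The defining formula in rank one.

  open Semantics (𝔸 K 1)

  -- Variables, innermost first: v′, v, u′, u, D, x, a.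
  unitsF : Formula 7 → Formula 7
  unitsF φ = ((var (# 3) ⊗ var (# 2)) ≐ 𝟙) ⇒f (((var (# 1) ⊗ var (# 0)) ≐ 𝟙) ⇒f φ)

  -- Variables, innermost first: H, G, d′, d, c′, c, v′, v, u′, u, D, x, a.
  interpolationAtF : Formula 13
  interpolationAtF =
    ((var (# 5) ⊗ var (# 4)) ≐ 𝟙) ∧f (((var (# 3) ⊗ var (# 2)) ≐ 𝟙) ∧f
    (((var (# 11) ⊕ (l ⊗ var (# 1))) ≐ (k ⊕ (var (# 12) ⊗ var (# 1)))) ∧f
     ((var (# 10) ⊕ (l ⊗ var (# 0))) ≐ (k ⊕ (var (# 11) ⊗ var (# 0))))))
    where
    l k : Term 13
    l = var (# 9) ⊕ var (# 7)
    k = var (# 5) ⊕ var (# 3)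

  interpolatedF : Formula 1
  interpolatedF = ∀f (∃f (∀f (∀f (∀f (∀f (unitsF (∃f (∃f (∃f (∃f (∃f (∃f interpolationAtF))))))))))))

  ⊨interpolatedF : ∀ a → (⊨ interpolatedF [ a ]) ⇔ IsFreeBasis a
  ⊨interpolatedF a = mk⇔ to from
    where
    to : ⊨ interpolatedF [ a ] → IsFreeBasis a
    to h = interpolated⇒basis a (let (D , i) = h X in D , λ u u′ v v′ uu′ vv′ →
      let (c , c′ , d , d′ , G , H , cc′ , dd′ , eq₁ , eq₂) = i u u′ v v′ (lift (≃⇒≈A uu′)) (lift (≃⇒≈A vv′)) in
      c , c′ , d , d′ , G , H , ≈A⇒≃ (lower cc′) , ≈A⇒≃ (lower dd′) , ≈A⇒≃ (lower eq₁) , ≈A⇒≃ (lower eq₂))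
    from : IsFreeBasis a → ⊨ interpolatedF [ a ]
    from basis x = let (D , i) = basis⇒interpolated a basis x in D , λ u u′ v v′ uu′ vv′ →
      let (c , c′ , d , d′ , G , H , cc′ , dd′ , eq₁ , eq₂) = i u u′ v v′ (≈A⇒≃ (lower uu′)) (≈A⇒≃ (lower vv′)) in
      c , c′ , d , d′ , G , H , lift (≃⇒≈A cc′) , lift (≃⇒≈A dd′) , lift (≃⇒≈A eq₁) , lift (≃⇒≈A eq₂)

-- Rank zero.

module FreeBasesRank0 {c ℓ : Level} (K : Field c ℓ) where
  open Field K hiding (zero)
  open FreeAlgebra K 0
  open Functionals K 0
  open Evaluation K 0

  -- The empty word is the only word, so evaluation is the identity.
  isFreeBasis : ∀ a → IsFreeBasis a
  isFreeBasis a = (λ p eval≈0 w → trans (sym (≃⇒≈A (eval-identity p) w)) (eval≈0 w)) ,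
    λ q → q , ≃⇒≈A (eval-identity q)
    where
    eval-identity : ∀ p → evalAt a p ≃ p
    eval-identity p = by-functionals λ f → trans (⟨⟩-eval a p) (⟨⟩-cong p λ { [] → ⟨word⟩ [] f })

theorem6p14 : {c ℓ : Level} (K : Field c ℓ) → Infinite K → (n : ℕ) →
    Σ (Formula n) λ Gen →
    (a : Fin n → FreeAlgebra.A K n) →
    (Semantics.⊨_[_] (𝔸 K n) Gen a ⇔ FreeAlgebra.IsFreeBasis K n a)
theorem6p14 K infinite zero          = 𝟘 ≐ 𝟘 , λ a →
  mk⇔ (λ _ → FreeBasesRank0.isFreeBasis K a) (λ _ → lift λ _ → Field.refl K)
theorem6p14 K infinite (suc zero)    = Univariate.interpolatedF K infinite , Univariate.⊨interpolatedF K infinite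
theorem6p14 K infinite (suc (suc m)) = FreeBasesRank≥2.genF K m , FreeBasesRank≥2.⊨genF K m
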